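{- For each $k\in\{3,4,6\}$, the limit $$ {\rm cl}(R_k)=\lim_{n\to\infty}\frac{k\cdot {\rm cl}(R_k(n),C_k)}{\|R_k(n)\|}$$ exists and equals $\frac{2}{k+1}$.
   Context: For $k\in\{3,4,6\}$, $R_k$ is the infinite plane graph of the regular tiling of the Euclidean plane by unit-side regular $k$-gons (triangular, square, hexagonal tiling respectively), whose vertices and edges are the vertices and sides of the $k$-gons, positioned so that there is an edge between the points $(0,0)$ and $(1,0)$. For a positive integer $n$, $R_k(n)$ is the subgraph of $R_k$ induced by the vertices lying in $[0,n)\times[0,n)$. $C_k$ is the cycle of length $k$; $\|G\|$ denotes the number of edges of $G$. A copy of $H$ in $G$ is a subgraph isomorphic to $H$; an $H$-packing of $G$ is a set of pairwise edge-disjoint copies of $H$ in $G$; it is maximal if no other $H$-packing of $G$ properly contains it; $ {\rm cl}(G,H)$ is the minimum cardinality of a maximal $H$-packing of $G$. -}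

module Defs where

open import Data.Bool using (Bool; true; false; _∧_; _∨_; not; T; if_then_else_)
open import Data.Nat as ℕ using (ℕ; suc; ∣_-_∣)
open import Data.Integer as ℤ using (ℤ; +_; _≤ᵇ_; _%ℕ_)
open import Data.Product using (_×_; _,_; proj₁; proj₂; Σ-syntax)
open import Data.Sum using (_⊎_)
open import Data.List using (List; []; _∷_; _++_; [_]; zip; length; map; concatMap; upTo)
open import Data.Bool.ListAction using (any)
open import Data.Nat.ListAction using (sum)
open import Data.List.Relation.Unary.All using (All)
open import Data.List.Relation.Unary.AllPairs using (AllPairs)
open import Data.List.Relation.Unary.Unique.Propositional using (Unique)
open import Data.List.Membership.Propositional using (_∈_)
open import Relation.Nullary using (¬_; does)
open import Relation.Binary.PropositionalEquality using (_≡_)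

data Tiling : Set where
  tri sq hex : Tiling

sides : Tiling → ℕ
sides tri = 3
sides sq  = 4
sides hex = 6

-- A vertex is given by integer lattice coordinates (a , b).
--  * sq      : (a , b) is the point (a , b).
--  * tri/hex : (a , b) is the point a·(1,0) + b·(1/2, √3/2)
--              = (a + b/2 , b·√3/2).
-- The triangular tiling R_3 has all these points as vertices, and the
-- unit-distance pairs (lattice differences ±(1,0), ±(0,1), ±(1,-1)) as edges.
-- The hexagonal tiling R_6 containing the edge (0,0)-(1,0) is obtained from
-- the triangular lattice by deleting the hexagon centres, which are exactly
-- the points with (a - b) mod 3 = 2 (e.g. (1/2, √3/2) = (0,1)); its edges are
-- the unit-distance pairs of remaining points.
V : Set
V = ℤ × ℤ

infix 4 _==_ _<ᵇ_
_==_ : ℤ → ℤ → Bool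
x == y = does (x ℤ.≟ y)

_<ᵇ_ : ℤ → ℤ → Bool
x <ᵇ y = (x ℤ.+ + 1) ≤ᵇ y

inR : Tiling → ℕ → V → Bool
inR sq n (a , b) = (+ 0 ≤ᵇ a) ∧ (a <ᵇ + n) ∧ (+ 0 ≤ᵇ b) ∧ (b <ᵇ + n)
inR tri n (a , b) =
  -- y = b√3/2 ∈ [0,n)  ⇔  b ≥ 0 ∧ 3b² < 4n² ;  x = a + b/2 ∈ [0,n) ⇔ 0 ≤ 2a+b < 2n
  (+ 0 ≤ᵇ b) ∧ ((+ 3 ℤ.* b ℤ.* b) <ᵇ (+ 4 ℤ.* + n ℤ.* + n))
  ∧ (+ 0 ≤ᵇ (+ 2 ℤ.* a ℤ.+ b)) ∧ ((+ 2 ℤ.* a ℤ.+ b) <ᵇ (+ 2 ℤ.* + n))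
inR hex n (a , b) = inR tri n (a , b) ∧ not (((a ℤ.- b) %ℕ 3) ℕ.≡ᵇ 2)

steps : Tiling → List V
steps sq  = (+ 1 , + 0) ∷ (ℤ.- + 1 , + 0) ∷ (+ 0 , + 1) ∷ (+ 0 , ℤ.- + 1) ∷ []
steps _   = (+ 1 , + 0) ∷ (ℤ.- + 1 , + 0) ∷ (+ 0 , + 1) ∷ (+ 0 , ℤ.- + 1)
          ∷ (+ 1 , ℤ.- + 1) ∷ (ℤ.- + 1 , + 1) ∷ []

adj : Tiling → V → V → Bool
adj t (a , b) (c , d) =
  any (λ s → ((c ℤ.- a) == proj₁ s) ∧ ((d ℤ.- b) == proj₂ s)) (steps t)

adjR : Tiling → ℕ → V → V → Bool
adjR t n u v = inR t n u ∧ inR t n v ∧ adj t u v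

-- ‖R_t(n)‖ : number of edges.  All vertices of R_t(n) have coordinates
-- a ∈ [-2n, 2n], b ∈ [0, 2n]; we enumerate this box.

box : ℕ → List V
box n = concatMap (λ i → map (λ j → (+ i ℤ.- + (2 ℕ.* n) , + j)) (upTo (suc (2 ℕ.* n))))
                  (upTo (suc (4 ℕ.* n)))

vertices : Tiling → ℕ → List V
vertices t n = Data.List.filterᵇ (inR t n) (box n)

orderedEdges : Tiling → ℕ → ℕ
orderedEdges t n =
  sum (map (λ u → sum (map (λ v → if adjR t n u v then 1 else 0) (vertices t n)))
           (vertices t n))

‖R‖ : Tiling → ℕ → ℕ
‖R‖ t n = orderedEdges t n ℕ./ 2

rot : {A : Set} → List A → List A
rot []       = []
rot (x ∷ xs) = xs ++ [ x ]

cycEdges : List V → List (V × V)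
cycEdges vs = zip vs (rot vs)

record Copy (t : Tiling) (n : ℕ) : Set where
  field
    verts    : List V
    len      : length verts ≡ sides t
    inside   : All (λ v → T (inR t n v)) verts
    distinct : Unique verts
    adjacent : All (λ e → T (adjR t n (proj₁ e) (proj₂ e))) (cycEdges verts)
open Copy public

SameEdge : V × V → V × V → Set
SameEdge (u , v) (x , y) = (u ≡ x × v ≡ y) ⊎ (u ≡ y × v ≡ x)

EdgeDisjoint : {t : Tiling} {n : ℕ} → Copy t n → Copy t n → Set
EdgeDisjoint C D = ∀ {e f} → e ∈ cycEdges (verts C) → f ∈ cycEdges (verts D) → ¬ SameEdge e f

-- A C_k-packing: a list of pairwise (position-wise) edge-disjoint copies.
-- (Edge-disjointness forces the listed copies to be distinct, so the list
-- is a set of copies and its length is the cardinality.)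
IsPacking : {t : Tiling} {n : ℕ} → List (Copy t n) → Set
IsPacking P = AllPairs EdgeDisjoint P

IsMaximalPacking : {t : Tiling} {n : ℕ} → List (Copy t n) → Set
IsMaximalPacking {t} {n} P = IsPacking P × (∀ (C : Copy t n) → ¬ All (EdgeDisjoint C) P)

IsCl : Tiling → ℕ → ℕ → Set
IsCl t n c =
  (Σ[ P ∈ List (Copy t n) ] (IsMaximalPacking P × length P ≡ c))
  × (∀ (P : List (Copy t n)) → IsMaximalPacking P → c ℕ.≤ length P)

{-# OPTIONS --safe #-}
module Submission where

-- Every k-cycle of R_k bounds a face.  Colour the faces with k + 1 colours by a linear form modulo k + 1,
-- chosen so that each face and its k neighbours carry all k + 1 colours.
-- Lower bound: in a maximal packing every face of R_k(n) shares an edge with a packed face (or is one), and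
-- is determined by that face and its own colour; a dart (directed edge) is determined by the face to its left
-- and its position there.  So, up to the O(n) darts whose left face leaves R_k(n), the 2‖R_k(n)‖ darts inject
-- into (packing) × (k + 1 colours) × (k positions).
-- Upper bound: the faces of one colour are pairwise edge-disjoint, and some colour is used by at most 1/(k + 1)
-- of the faces.  When the packing by these faces is extended to a maximal one, each new copy has a neighbour of
-- the chosen colour outside R_k(n), so there are only O(n) new copies.

open import Defs
open import Data.Nat using (ℕ; suc; _+_; _*_; _≤_; _<_; ∣_-_∣)
open import Data.Product using (_×_; Σ-syntax; ∃-syntax)
open import Data.Nat as ℕ using (zero; z≤n; s≤s)
import Data.Nat.Properties as ℕₚ
import Data.Nat.DivMod as ℕ÷
import Data.Nat.Tactic.RingSolver as ℕS
open import Data.Nat.ListAction using (sum)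
open import Data.Bool using (Bool; true; false; T; T?; not; _∧_; _∨_; if_then_else_)
open import Data.Bool.ListAction using (all)
open import Data.Integer as ℤ using (ℤ; +_; -[1+_]; _%ℕ_; _/ℕ_)
import Data.Integer.Properties as ℤₚ
open import Data.Integer.DivMod using (n%ℕd<d; a≡a%ℕn+[a/ℕn]*n)
open import Data.Integer.Tactic.RingSolver using (solve-∀)
open import Data.Fin as Fin using (Fin; zero; suc; toℕ; fromℕ<; combine; #_)
import Data.Fin.Properties as Finₚ
open import Data.Fin.Properties using (all?; any?)
open import Data.Unit using (⊤; tt)
open import Data.Empty using (⊥)
open import Data.Product using (_,_; proj₁; proj₂; Σ; uncurry)
open import Data.Product.Properties using (≡-dec)
open import Data.Sum using (_⊎_; inj₁; inj₂; [_,_]′)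
open import Data.Maybe using (Maybe; just; nothing)
open import Data.List using (List; []; _∷_; _++_; [_]; length; map; lookup; zip; iterate; allFin; upTo;
  filter; filterᵇ; concatMap; mapMaybe; cartesianProduct; cartesianProductWith)
import Data.List.Properties as Listₚ
import Data.Vec as Vec
open Vec using ([]; _∷_)
open import Data.List.Relation.Unary.All as All using (All; []; _∷_)
import Data.List.Relation.Unary.All.Properties as Allₚ
open import Data.List.Relation.Unary.Any as Any using (Any; here; there)
import Data.List.Relation.Unary.Any.Properties as Anyₚ
open import Data.List.Relation.Unary.AllPairs as AllPairs using (AllPairs; []; _∷_; allPairs?)
import Data.List.Relation.Unary.AllPairs.Properties as AllPairsₚ
open import Data.List.Relation.Unary.Unique.Propositional using (Unique)
import Data.List.Relation.Unary.Unique.Propositional.Properties as Uniqueₚ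
open import Data.List.Membership.Propositional using (_∈_; lose; find)
open import Data.List.Membership.Propositional.Properties
open import Relation.Nullary using (¬_; Dec; yes; no; contradiction; ¬?; does)
open import Relation.Nullary.Decidable using (map′; _×-dec_; _⊎-dec_; _→-dec_; toWitness; True)
open import Relation.Binary using (DecidableEquality; tri<; tri≈; tri>)
open import Relation.Binary.PropositionalEquality hiding ([_])
open import Function using (_∘_; id)

-- Counting by injections into Fin

-- The two bounds meet because the colouring is a perfect code: on a face together with its
-- neighbours the colour is a bijection. Injectivity controls an arbitrary maximal packing, whatever
-- its faces; surjectivity makes every single colour class dominating, except along the boundary.
-- All local facts depend on a base point only through its colour residue, or through its class
-- modulo 3 when deleted hexagon centres matter. Hence they are finite statements about directions
-- and residues, which evaluation decides for the three tilings at once. The boundary terms are O(n)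
-- because the window is convex along lattice lines: a fixed displacement leads out of it from O(n)
-- points only. They vanish in the limit because the number of edges grows like the square of n.

infix 4 _≲_

-- At most `N` elements satisfy `P`. The predicate may be undecidable and have many proofs: a code
-- may depend on the proof, but equal codes force equal elements whatever the proofs.
record _≲_ {A : Set} (P : A → Set) (N : ℕ) : Set where
  field
    code     : ∀ {x} → P x → Fin N
    code-inj : ∀ {x y} (p : P x) (q : P y) → code p ≡ code q → x ≡ y
open _≲_ public

module _ {A B : Set} {P : A → Set} {N : ℕ} {Q : B → Set} where
  ≲-map : (f : ∀ {y} → Q y → A) → (∀ {y} (q : Q y) → P (f q)) →
          (∀ {y z} (q : Q y) (r : Q z) → f q ≡ f r → y ≡ z) → P ≲ N → Q ≲ N
  ≲-map f g f-inj c .code q = code c (g q)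
  ≲-map f g f-inj c .code-inj q r e = f-inj q r (code-inj c (g q) (g r) e)

  ≲-× : ∀ {M} → P ≲ N → Q ≲ M → (λ (xy : A × B) → P (proj₁ xy) × Q (proj₂ xy)) ≲ N * M
  ≲-× c d .code (p , q) = combine (code c p) (code d q)
  ≲-× c d .code-inj (p , q) (p′ , q′) e
    with e₁ , e₂ ← Finₚ.combine-injective _ _ _ _ e
    = cong₂ _,_ (code-inj c p p′ e₁) (code-inj d q q′ e₂)

≲-Fin : ∀ {N} (P : Fin N → Set) → P ≲ N
≲-Fin P .code {x} _ = x
≲-Fin P .code-inj _ _ e = e

≲-⊎ : ∀ {A : Set} {P Q : A → Set} {M N} → P ≲ M → Q ≲ N → (λ x → P x ⊎ Q x) ≲ M + N
≲-⊎ {M = M} {N} c d .code (inj₁ p) = code c p Fin.↑ˡ N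
≲-⊎ {M = M} {N} c d .code (inj₂ q) = M Fin.↑ʳ code d q
≲-⊎ {M = M} {N} c d .code-inj (inj₁ p) (inj₁ q) e = code-inj c p q (Finₚ.↑ˡ-injective N _ _ e)
≲-⊎ {M = M} {N} c d .code-inj (inj₁ p) (inj₂ q) e
  with () ← trans (sym (Finₚ.splitAt-↑ˡ M (code c p) N)) (trans (cong (Fin.splitAt M) e) (Finₚ.splitAt-↑ʳ M N (code d q)))
≲-⊎ {M = M} {N} c d .code-inj (inj₂ p) (inj₁ q) e
  with () ← trans (sym (Finₚ.splitAt-↑ˡ M (code c q) N)) (trans (cong (Fin.splitAt M) (sym e)) (Finₚ.splitAt-↑ʳ M N (code d p)))
≲-⊎ {M = M} {N} c d .code-inj (inj₂ p) (inj₂ q) e = code-inj d p q (Finₚ.↑ʳ-injective M _ _ e)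

≲-∈ : ∀ {A : Set} (xs : List A) → (_∈ xs) ≲ length xs
≲-∈ xs .code = Any.index
≲-∈ xs .code-inj p q e = trans (Anyₚ.lookup-index p) (trans (cong (lookup xs) e) (sym (Anyₚ.lookup-index q)))

AllPairs-lookup : ∀ {A : Set} {R : A → A → Set} {xs} → AllPairs R xs →
                  ∀ i j → i Fin.< j → R (lookup xs i) (lookup xs j)
AllPairs-lookup (r ∷ rs) zero    (suc j) i<j       = All.lookup r (∈-lookup j)
AllPairs-lookup (r ∷ rs) (suc i) (suc j) (s≤s i<j) = AllPairs-lookup rs i j i<j

-- Two positions with the same value would contradict `R`. With inequality for `R` this counts lists
-- without repetition; with edge-disjointness it counts copies without comparing their proof fields.
AllPairs-length : ∀ {A : Set} {R : A → A → Set} {xs N} → AllPairs R xs →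
                  (f : ∀ {x} → x ∈ xs → Fin N) →
                  (∀ {x y} (p : x ∈ xs) (q : y ∈ xs) → f p ≡ f q → ¬ R x y) → length xs ≤ N
AllPairs-length {xs = xs} rs f clash = Finₚ.injective⇒≤ {f = λ i → f (∈-lookup i)} inj
  where
  inj : ∀ {i j} → f (∈-lookup i) ≡ f (∈-lookup j) → i ≡ j
  inj {i} {j} e with Finₚ.<-cmp i j
  ... | tri< i<j _ _ = contradiction (AllPairs-lookup rs i j i<j) (clash _ _ e)
  ... | tri≈ _ i≡j _ = i≡j
  ... | tri> _ _ j<i = contradiction (AllPairs-lookup rs j i j<i) (clash _ _ (sym e))

≲-length : ∀ {A : Set} {P : A → Set} {xs N} → Unique xs → (∀ {x} → x ∈ xs → P x) → P ≲ N → length xs ≤ N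
≲-length u p c = AllPairs-length u (λ x∈ → code c (p x∈)) (λ x∈ y∈ e x≢y → x≢y (code-inj c _ _ e))

-- Pigeonhole by injection: `suc m` copies of the smallest class fit into the list, copy number `h`
-- going into class `h`, which is at least as long.
fair-share : ∀ {A : Set} {m} (f : A → Fin (suc m)) {xs : List A} → Unique xs →
  ∃[ j ] suc m * length (filter (λ x → f x Finₚ.≟ j) xs) ≤ length xs
fair-share {A} {m} f {xs} u = j , ≤-bound
  where
  cls : Fin (suc m) → List A
  cls j = filter (λ x → f x Finₚ.≟ j) xs
  argmin : ∀ {n} (g : Fin (suc n) → ℕ) → ∃[ j ] ∀ i → g j ≤ g i
  argmin {zero} g = zero , λ { zero → ℕₚ.≤-refl }
  argmin {suc n} g with argmin (g ∘ suc)
  ... | i , least with ℕₚ.≤-total (g zero) (g (suc i))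
  ... | inj₁ le = zero , λ { zero → ℕₚ.≤-refl ; (suc h) → ℕₚ.≤-trans le (least h) }
  ... | inj₂ ge = suc i , λ { zero → ge ; (suc h) → least h }
  j = proj₁ (argmin (length ∘ cls))
  least = proj₂ (argmin (length ∘ cls))
  at : Fin (suc m) → Fin (length (cls j)) → A
  at h i = lookup (cls h) (Fin.inject≤ i (least h))
  at∈ : ∀ h i → at h i ∈ cls h
  at∈ h i = ∈-lookup (Fin.inject≤ i (least h))
  at-xs : ∀ h i → at h i ∈ xs × f (at h i) ≡ h
  at-xs h i = ∈-filter⁻ (λ x → f x Finₚ.≟ h) (at∈ h i)
  pos : Fin (suc m) × Fin (length (cls j)) → Fin (length xs)
  pos (h , i) = code (≲-∈ xs) (proj₁ (at-xs h i))
  lookup-inj : ∀ {ys : List A} → Unique ys → ∀ a b → lookup ys a ≡ lookup ys b → a ≡ b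
  lookup-inj us a b e with Finₚ.<-cmp a b
  ... | tri< a<b _ _ = contradiction e (AllPairs-lookup us a b a<b)
  ... | tri≈ _ a≡b _ = a≡b
  ... | tri> _ _ b<a = contradiction (sym e) (AllPairs-lookup us b a b<a)
  pos-inj : ∀ {x y} → pos x ≡ pos y → x ≡ y
  pos-inj {h , i} {h′ , i′} e with code-inj (≲-∈ xs) _ _ e
  ... | same with trans (sym (proj₂ (at-xs h i))) (trans (cong f same) (proj₂ (at-xs h′ i′)))
  ... | refl = cong (h ,_) (Finₚ.inject≤-injective _ _ i i′
                 (lookup-inj (Uniqueₚ.filter⁺ (λ x → f x Finₚ.≟ h) u) _ _ same))
  ≤-bound = Finₚ.injective⇒≤ {f = pos ∘ Fin.remQuot (length (cls j))}
              (λ {a} {b} e → trans (sym (Finₚ.combine-remQuot {suc m} (length (cls j)) a))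
                (trans (cong (uncurry combine) (pos-inj e)) (Finₚ.combine-remQuot {suc m} (length (cls j)) b)))

sum-indicators : ∀ {A B : Set} (p : A → B → Bool) (xs : List A) (ys : List B) →
  sum (map (λ x → sum (map (λ y → if p x y then 1 else 0) ys)) xs)
    ≡ length (filterᵇ (uncurry p) (cartesianProduct xs ys))
sum-indicators p [] ys = refl
sum-indicators {A} {B} p (x ∷ xs) ys = begin
  sum (map (λ y → if p x y then 1 else 0) ys) + _
    ≡⟨ cong₂ _+_ (row ys) (sum-indicators p xs ys) ⟩
  length (filterᵇ (uncurry p) (map (x ,_) ys)) + length (filterᵇ (uncurry p) (cartesianProduct xs ys))
    ≡⟨ Listₚ.length-++ (filterᵇ (uncurry p) (map (x ,_) ys)) ⟨
  length (filterᵇ (uncurry p) (map (x ,_) ys) ++ filterᵇ (uncurry p) (cartesianProduct xs ys))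
    ≡⟨ cong length (Listₚ.filter-++ _ (map (x ,_) ys) (cartesianProduct xs ys)) ⟨
  length (filterᵇ (uncurry p) (map (x ,_) ys ++ cartesianProduct xs ys)) ∎
  where
  open ≡-Reasoning
  row : ∀ ys → sum (map (λ y → if p x y then 1 else 0) ys) ≡ length (filterᵇ (uncurry p) (map (x ,_) ys))
  row [] = refl
  row (y ∷ ys) with p x y
  ... | true  = cong suc (row ys)
  ... | false = row ys

-- Maximal packings

listsOf : {A : Set} → ℕ → List A → List (List A)
listsOf zero    xs = [] ∷ []
listsOf (suc n) xs = cartesianProductWith _∷_ xs (listsOf n xs)

listsOf-complete : ∀ {A : Set} {xs : List A} ys → All (_∈ xs) ys → ys ∈ listsOf (length ys) xs
listsOf-complete []       []       = here refl
listsOf-complete (y ∷ ys) (p ∷ ps) = ∈-cartesianProductWith⁺ _∷_ p (listsOf-complete ys ps)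

listsOf-length : ∀ {A : Set} n {xs : List A} {ys} → ys ∈ listsOf n xs → length ys ≡ n
listsOf-length zero (here refl) = refl
listsOf-length (suc n) {xs} ys∈ with ∈-cartesianProductWith⁻ _∷_ xs (listsOf n xs) ys∈
... | _ , _ , _ , zs∈ , refl = cong suc (listsOf-length n zs∈)

least : ∀ {Q : ℕ → Set} → (∀ n → Dec (Q n)) → ∀ n → Q n → ∃[ c ] Q c × (∀ m → Q m → c ≤ m)
least Q? zero q = zero , q , λ _ _ → z≤n
least Q? (suc n) q with Q? zero
... | yes q₀ = zero , q₀ , λ _ _ → z≤n
... | no ¬q₀ with least (Q? ∘ suc) n q
... | c , qc , min = suc c , qc , λ { zero q₀ → contradiction q₀ ¬q₀ ; (suc m) qm → s≤s (min m qm) }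

-- Copies carry proofs, so `reps` need not list them all: it suffices that each is interchangeable
-- with a listed one as far as `∥` can tell. Maximality then becomes a finite check and the minimum
-- a finite search.
module Packings {A : Set} (_∥_ : A → A → Set) (_∥?_ : ∀ a b → Dec (a ∥ b))
  (∥-sym : ∀ {a b} → a ∥ b → b ∥ a) (∥-irrefl : ∀ a → ¬ a ∥ a)
  (reps : List A)
  (rep : A → A) (rep∈ : ∀ a → rep a ∈ reps)
  (rep-∥⁺ : ∀ a {b} → a ∥ b → rep a ∥ b) (rep-∥⁻ : ∀ a {b} → rep a ∥ b → a ∥ b)
  where

  Maximal : List A → Set
  Maximal P = AllPairs _∥_ P × (∀ a → ¬ All (a ∥_) P)

  maximal? : ∀ P → Dec (Maximal P)
  maximal? P = allPairs? _∥?_ P ×-dec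
    map′ (λ ne a a∥P → All.lookup ne (rep∈ a) (All.map (rep-∥⁺ a) a∥P)) (λ ne → All.tabulate λ {a} _ → ne a)
         (All.all? (λ a → ¬? (All.all? (a ∥?_) P)) reps)

  Maximal-rep : ∀ {P} → Maximal P → Maximal (map rep P)
  Maximal-rep (disj , max) =
    AllPairsₚ.map⁺ (AllPairs.map (λ {a} {b} a∥b → rep-∥⁺ a (∥-sym (rep-∥⁺ b (∥-sym a∥b)))) disj) ,
    λ a a∥P → max a (All.map (λ {b} a∥b → ∥-sym (rep-∥⁻ b (∥-sym a∥b))) (Allₚ.map⁻ a∥P))

  maximalOfLength? : ∀ n → Dec (∃[ P ] Maximal P × length P ≡ n)
  maximalOfLength? n = map′
    (λ any → let P , P∈ , max = find any in P , max , listsOf-length n P∈)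
    (λ { (P , max , refl) → lose
           (subst (λ l → map rep P ∈ listsOf l reps) (Listₚ.length-map rep P)
             (listsOf-complete (map rep P) (Allₚ.map⁺ (All.tabulate λ {a} _ → rep∈ a))))
           (Maximal-rep max) })
    (Any.any? maximal? (listsOf n reps))

  -- Greedy choice in one pass: an added representative is blocked by itself, by `∥-irrefl`, and a
  -- rejected one stays blocked as the list grows.
  extend : ∀ {P} → AllPairs _∥_ P →
    ∃[ Q ] AllPairs _∥_ Q × All (λ a → All (a ∥_) P) Q × Maximal (Q ++ P)
  extend {P} disj with go reps
    where
    go : ∀ as → ∃[ Q ] AllPairs _∥_ Q × All (λ a → All (a ∥_) P) Q × All (λ a → ¬ All (a ∥_) (Q ++ P)) as
    go [] = [] , [] , [] , []
    go (a ∷ as) with go as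
    ... | Q , pairs , new , ok with All.all? (a ∥?_) (Q ++ P)
    ... | yes a∥ = a ∷ Q , Allₚ.++⁻ˡ Q a∥ ∷ pairs , Allₚ.++⁻ʳ Q a∥ ∷ new ,
                   (λ { (a∥a ∷ _) → ∥-irrefl a a∥a }) ∷ All.map (λ { ne (_ ∷ b∥) → ne b∥ }) ok
    ... | no ¬a∥ = Q , pairs , new , ¬a∥ ∷ ok
  ... | Q , pairs , new , ok = Q , pairs , new , AllPairsₚ.++⁺ pairs disj new ,
        λ a a∥ → All.lookup ok (rep∈ a) (All.map (rep-∥⁺ a) a∥)

  least-maximal : ∃[ c ] (∃[ P ] Maximal P × length P ≡ c) × (∀ P → Maximal P → c ≤ length P)
  least-maximal with extend []
  ... | Q , _ , _ , max with least maximalOfLength? (length (Q ++ [])) (Q ++ [] , max , refl)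
  ... | c , wit , min = c , wit , λ P maxP → min (length P) (P , maxP , refl)

-- Copies, their edges, and the finite search over them

infix 4 _≟V_
_≟V_ : DecidableEquality V
_≟V_ = ≡-dec ℤ._≟_ ℤ._≟_

sameEdge? : ∀ e f → Dec (SameEdge e f)
sameEdge? (u , v) (x , y) = ((u ≟V x) ×-dec (v ≟V y)) ⊎-dec ((u ≟V y) ×-dec (v ≟V x))

SameEdge-sym : ∀ {e f} → SameEdge e f → SameEdge f e
SameEdge-sym (inj₁ (refl , refl)) = inj₁ (refl , refl)
SameEdge-sym (inj₂ (refl , refl)) = inj₂ (refl , refl)

SameEdge-trans : ∀ {e f g} → SameEdge e f → SameEdge f g → SameEdge e g
SameEdge-trans (inj₁ (refl , refl)) s = s
SameEdge-trans (inj₂ (refl , refl)) (inj₁ (refl , refl)) = inj₂ (refl , refl)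
SameEdge-trans (inj₂ (refl , refl)) (inj₂ (refl , refl)) = inj₁ (refl , refl)

module _ {t : Tiling} {n : ℕ} where
  Meet : Copy t n → Copy t n → Set
  Meet C D = ∃[ e ] ∃[ f ] e ∈ cycEdges (verts C) × f ∈ cycEdges (verts D) × SameEdge e f

  meet? : ∀ C D → Dec (Meet C D)
  meet? C D = map′
    (λ any → let e , e∈ , any′ = find any ; f , f∈ , same = find any′ in e , f , e∈ , f∈ , same)
    (λ { (e , f , e∈ , f∈ , same) → lose e∈ (lose f∈ same) })
    (Any.any? (λ e → Any.any? (sameEdge? e) (cycEdges (verts D))) (cycEdges (verts C)))

  disjoint? : ∀ (C D : Copy t n) → Dec (EdgeDisjoint C D)
  disjoint? C D = map′ (λ ¬m e∈ f∈ same → ¬m (_ , _ , e∈ , f∈ , same))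
    (λ disj → λ { (_ , _ , e∈ , f∈ , same) → disj e∈ f∈ same }) (¬? (meet? C D))

  -- Deciding `Meet` turns a mere failure of disjointness into an actual shared edge.
  meets-member : ∀ C P → ¬ All (EdgeDisjoint C) P → ∃[ i ] Meet C (lookup P i)
  meets-member C [] ne = contradiction [] ne
  meets-member C (D ∷ P) ne with meet? C D
  ... | yes meet = zero , meet
  ... | no ¬meet with meets-member C P (λ disj → ne ((λ e∈ f∈ same → ¬meet (_ , _ , e∈ , f∈ , same)) ∷ disj))
  ... | i , meet = suc i , meet

  disjoint-sym : {C D : Copy t n} → EdgeDisjoint C D → EdgeDisjoint D C
  disjoint-sym disj e∈ f∈ same = disj f∈ e∈ (SameEdge-sym same)

  disjoint-irrefl : (C : Copy t n) → ¬ EdgeDisjoint C C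
  disjoint-irrefl record { verts = [] ; len = e } disj = nonempty t e
    where
    nonempty : ∀ t → 0 ≢ sides t
    nonempty tri ()
    nonempty sq ()
    nonempty hex ()
  disjoint-irrefl record { verts = v ∷ [] } disj = disj (here refl) (here refl) (inj₁ (refl , refl))
  disjoint-irrefl record { verts = v ∷ w ∷ vs } disj = disj (here refl) (here refl) (inj₁ (refl , refl))

  module _ (vs : List V) (inside? : ∀ v → T (inR t n v) → v ∈ vs) where
    -- Only the vertex list of a copy is kept; deciding the other fields afresh gives a canonical
    -- copy with the same vertices, and there are finitely many vertex lists.
    copy? : (us : List V) → Maybe (Copy t n)
    copy? us with length us ℕ.≟ sides t | All.all? (λ v → T? (inR t n v)) us
      | allPairs? (λ u v → ¬? (u ≟V v)) us | All.all? (λ e → T? (adjR t n (proj₁ e) (proj₂ e))) (cycEdges us)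
    ... | yes l | yes i | yes d | yes a = just record { verts = us ; len = l ; inside = i ; distinct = d ; adjacent = a }
    ... | _ | _ | _ | _ = nothing

    copy?-complete : (C : Copy t n) → ∃[ D ] copy? (verts C) ≡ just D × verts D ≡ verts C
    copy?-complete C with length (verts C) ℕ.≟ sides t | All.all? (λ v → T? (inR t n v)) (verts C)
      | allPairs? (λ u v → ¬? (u ≟V v)) (verts C) | All.all? (λ e → T? (adjR t n (proj₁ e) (proj₂ e))) (cycEdges (verts C))
    ... | yes l | yes i | yes d | yes a = _ , refl , refl
    ... | no ¬l | _ | _ | _ = contradiction (len C) ¬l
    ... | yes _ | no ¬i | _ | _ = contradiction (inside C) ¬i
    ... | yes _ | yes _ | no ¬d | _ = contradiction (distinct C) ¬d
    ... | yes _ | yes _ | yes _ | no ¬a = contradiction (adjacent C) ¬a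

    copies : List (Copy t n)
    copies = mapMaybe copy? (listsOf (sides t) vs)

    repCopy : Copy t n → Copy t n
    repCopy C = proj₁ (copy?-complete C)

    repCopy∈ : ∀ C → repCopy C ∈ copies
    repCopy∈ C = mapMaybe∈ (subst (λ k → verts C ∈ listsOf k vs) (len C)
                   (listsOf-complete (verts C) (All.map (inside? _) (inside C))))
                   (proj₁ (proj₂ (copy?-complete C)))
      where
      mapMaybe∈ : ∀ {us uss D} → us ∈ uss → copy? us ≡ just D → D ∈ mapMaybe copy? uss
      mapMaybe∈ {us} (here refl) e rewrite e = here refl
      mapMaybe∈ {uss = us ∷ _} (there p) e with copy? us
      ... | just _ = there (mapMaybe∈ p e)
      ... | nothing = mapMaybe∈ p e

    open Packings (EdgeDisjoint {t} {n}) disjoint? (λ {C} {D} → disjoint-sym {C} {D}) disjoint-irrefl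
      copies repCopy repCopy∈
      (λ C disj {e} → subst (λ us → ∀ {f} → e ∈ cycEdges us → f ∈ _ → ¬ SameEdge e f) (sym (proj₂ (proj₂ (copy?-complete C)))) disj)
      (λ C disj {e} → subst (λ us → ∀ {f} → e ∈ cycEdges us → f ∈ _ → ¬ SameEdge e f) (proj₂ (proj₂ (copy?-complete C))) disj)
      public

-- Faces and colours

infixl 6 _⊕_ _⊖_

_⊕_ _⊖_ : V → V → V
(a , b) ⊕ (c , d) = a ℤ.+ c , b ℤ.+ d
(a , b) ⊖ (c , d) = a ℤ.- c , b ℤ.- d

𝟎 : V
𝟎 = + 0 , + 0

⊕-assoc : ∀ u v w → u ⊕ v ⊕ w ≡ u ⊕ (v ⊕ w)
⊕-assoc (a , b) (c , d) (e , f) = cong₂ _,_ (ℤₚ.+-assoc a c e) (ℤₚ.+-assoc b d f)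

⊕-identityʳ : ∀ v → v ⊕ 𝟎 ≡ v
⊕-identityʳ (a , b) = cong₂ _,_ (ℤₚ.+-identityʳ a) (ℤₚ.+-identityʳ b)

⊕-comm : ∀ u v → u ⊕ v ≡ v ⊕ u
⊕-comm (a , b) (c , d) = cong₂ _,_ (ℤₚ.+-comm a c) (ℤₚ.+-comm b d)

⊖-⊕ : ∀ u v → u ⊖ v ⊕ v ≡ u
⊖-⊕ (a , b) (c , d) = cong₂ _,_ (lemma a c) (lemma b d)
  where
  lemma : ∀ x y → x ℤ.- y ℤ.+ y ≡ x
  lemma = solve-∀

⊕-⊖ : ∀ u v → u ⊕ v ⊖ v ≡ u
⊕-⊖ (a , b) (c , d) = cong₂ _,_ (lemma a c) (lemma b d)
  where
  lemma : ∀ x y → x ℤ.+ y ℤ.- y ≡ x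
  lemma = solve-∀

⊕-cancelʳ : ∀ u {v w} → v ⊕ u ≡ w ⊕ u → v ≡ w
⊕-cancelʳ u {v} {w} eq = trans (sym (⊕-⊖ v u)) (trans (cong (_⊖ u) eq) (⊕-⊖ w u))

⊕-cancelˡ : ∀ u {v w} → u ⊕ v ≡ u ⊕ w → v ≡ w
⊕-cancelˡ u {v} {w} eq = ⊕-cancelʳ u (trans (⊕-comm v u) (trans eq (⊕-comm u w)))

residue : ∀ m → ℤ → Fin (suc m)
residue m z = fromℕ< (n%ℕd<d z (suc m))

remainder-unique : ∀ m {r s} q p → r < suc m → s < suc m →
  + r ℤ.+ q ℤ.* + suc m ≡ + s ℤ.+ p ℤ.* + suc m → r ≡ s
remainder-unique m {r} {s} q p r< s< eq = go (q ℤ.- p) s-r≡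
  where
  s-r≡ : + s ≡ + r ℤ.+ (q ℤ.- p) ℤ.* + suc m
  s-r≡ = begin
    + s ≡⟨ rearrange (+ s) p (+ suc m) ⟨
    + s ℤ.+ p ℤ.* + suc m ℤ.- p ℤ.* + suc m ≡⟨ cong (ℤ._- p ℤ.* + suc m) eq ⟨
    + r ℤ.+ q ℤ.* + suc m ℤ.- p ℤ.* + suc m ≡⟨ collect (+ r) q p (+ suc m) ⟩
    + r ℤ.+ (q ℤ.- p) ℤ.* + suc m ∎
    where
    open ≡-Reasoning
    rearrange : ∀ x y z → x ℤ.+ y ℤ.* z ℤ.- y ℤ.* z ≡ x
    rearrange = solve-∀
    collect : ∀ w x y z → w ℤ.+ x ℤ.* z ℤ.- y ℤ.* z ≡ w ℤ.+ (x ℤ.- y) ℤ.* z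
    collect = solve-∀
  go : ∀ k → + s ≡ + r ℤ.+ k ℤ.* + suc m → r ≡ s
  go (+ zero) e = sym (trans (ℤₚ.+-injective e) (ℕₚ.+-identityʳ r))
  go (+ suc k) e = contradiction s< (ℕₚ.≤⇒≯ (ℕₚ.≤-trans (ℕₚ.≤-trans (ℕₚ.m≤m+n (suc m) (k * suc m)) (ℕₚ.m≤n+m _ r))
    (ℕₚ.≤-reflexive (sym (ℤₚ.+-injective e)))))
  go -[1+ k ] e = contradiction r< (ℕₚ.≤⇒≯ (ℕₚ.≤-trans (ℕₚ.≤-trans (ℕₚ.m≤m+n (suc m) (k * suc m)) (ℕₚ.m≤n+m _ s))
    (ℕₚ.≤-reflexive (sym (ℤₚ.+-injective r≡)))))
    where
    r≡ : + r ≡ + (s + (suc m + k * suc m))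
    r≡ = begin
      + r ≡⟨ cancel (+ r) (+ (suc m + k * suc m)) ⟨
      + r ℤ.+ ℤ.- + (suc m + k * suc m) ℤ.+ + (suc m + k * suc m) ≡⟨ cong (ℤ._+ + (suc m + k * suc m)) e ⟨
      + s ℤ.+ + (suc m + k * suc m) ≡⟨ ℤₚ.pos-+ s _ ⟨
      + (s + (suc m + k * suc m)) ∎
      where
      open ≡-Reasoning
      cancel : ∀ x y → x ℤ.+ ℤ.- y ℤ.+ y ≡ x
      cancel = solve-∀

-- Replacing `z` by its residue reduces a claim about all base points to one about finitely many
-- residues.
residue-+ : ∀ m z w → residue m (z ℤ.+ w) ≡ residue m (+ toℕ (residue m z) ℤ.+ w)
residue-+ m z w = Finₚ.fromℕ<-cong _ _ (remainder-unique m ((z ℤ.+ w) /ℕ suc m) (z /ℕ suc m ℤ.+ (r′ ℤ.+ w) /ℕ suc m)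
    (n%ℕd<d (z ℤ.+ w) (suc m)) (n%ℕd<d (r′ ℤ.+ w) (suc m)) eq) _ _
  where
  r′ = + toℕ (residue m z)
  eq : + ((z ℤ.+ w) %ℕ suc m) ℤ.+ (z ℤ.+ w) /ℕ suc m ℤ.* + suc m
     ≡ + ((r′ ℤ.+ w) %ℕ suc m) ℤ.+ (z /ℕ suc m ℤ.+ (r′ ℤ.+ w) /ℕ suc m) ℤ.* + suc m
  eq = begin
    + ((z ℤ.+ w) %ℕ suc m) ℤ.+ (z ℤ.+ w) /ℕ suc m ℤ.* + suc m ≡⟨ a≡a%ℕn+[a/ℕn]*n (z ℤ.+ w) (suc m) ⟨
    z ℤ.+ w ≡⟨ cong (ℤ._+ w) (a≡a%ℕn+[a/ℕn]*n z (suc m)) ⟩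
    + (z %ℕ suc m) ℤ.+ z /ℕ suc m ℤ.* + suc m ℤ.+ w
      ≡⟨ cong (λ r → + r ℤ.+ z /ℕ suc m ℤ.* + suc m ℤ.+ w) (Finₚ.toℕ-fromℕ< (n%ℕd<d z (suc m))) ⟨
    r′ ℤ.+ z /ℕ suc m ℤ.* + suc m ℤ.+ w ≡⟨ shuffle r′ (z /ℕ suc m) (+ suc m) w ⟩
    (r′ ℤ.+ w) ℤ.+ z /ℕ suc m ℤ.* + suc m
      ≡⟨ cong (ℤ._+ z /ℕ suc m ℤ.* + suc m) (a≡a%ℕn+[a/ℕn]*n (r′ ℤ.+ w) (suc m)) ⟩
    + ((r′ ℤ.+ w) %ℕ suc m) ℤ.+ (r′ ℤ.+ w) /ℕ suc m ℤ.* + suc m ℤ.+ z /ℕ suc m ℤ.* + suc m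
      ≡⟨ collect (+ ((r′ ℤ.+ w) %ℕ suc m)) ((r′ ℤ.+ w) /ℕ suc m) (z /ℕ suc m) (+ suc m) ⟩
    + ((r′ ℤ.+ w) %ℕ suc m) ℤ.+ (z /ℕ suc m ℤ.+ (r′ ℤ.+ w) /ℕ suc m) ℤ.* + suc m ∎
    where
    open ≡-Reasoning
    shuffle : ∀ r q n w → r ℤ.+ q ℤ.* n ℤ.+ w ≡ (r ℤ.+ w) ℤ.+ q ℤ.* n
    shuffle = solve-∀
    collect : ∀ r q p n → r ℤ.+ q ℤ.* n ℤ.+ p ℤ.* n ≡ r ℤ.+ (p ℤ.+ q) ℤ.* n
    collect = solve-∀

-- Directions are indexed as in `steps`, and the dart of direction d has one face on its left.  A face is given
-- by a base point and any of the directions of its boundary, which is traversed counterclockwise: `next` is the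
-- direction of the following side, and `off` leads from the base point to the start of the side.
-- `op` is the opposite direction, `rep` a canonical side of each of the (one or two) shapes of faces, and `pos`
-- the number of sides from there.
Dir : Tiling → Set
Dir t = Fin (length (steps t))

step : ∀ t → Dir t → V
step t = lookup (steps t)

op next rep : ∀ t → Dir t → Dir t
op sq  = Vec.lookup (# 1 ∷ # 0 ∷ # 3 ∷ # 2 ∷ [])
op tri = Vec.lookup (# 1 ∷ # 0 ∷ # 3 ∷ # 2 ∷ # 5 ∷ # 4 ∷ [])
op hex = Vec.lookup (# 1 ∷ # 0 ∷ # 3 ∷ # 2 ∷ # 5 ∷ # 4 ∷ [])

next sq  = Vec.lookup (# 2 ∷ # 3 ∷ # 1 ∷ # 0 ∷ [])
next tri = Vec.lookup (# 5 ∷ # 4 ∷ # 1 ∷ # 0 ∷ # 2 ∷ # 3 ∷ [])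
next hex = Vec.lookup (# 2 ∷ # 3 ∷ # 5 ∷ # 4 ∷ # 0 ∷ # 1 ∷ [])

rep tri = Vec.lookup (# 0 ∷ # 2 ∷ # 2 ∷ # 0 ∷ # 2 ∷ # 0 ∷ [])
rep sq  _ = # 0
rep hex _ = # 0

pos : ∀ t → Dir t → Fin (sides t)
pos sq  = Vec.lookup (# 0 ∷ # 2 ∷ # 1 ∷ # 3 ∷ [])
pos tri = Vec.lookup (# 0 ∷ # 1 ∷ # 0 ∷ # 2 ∷ # 2 ∷ # 1 ∷ [])
pos hex = Vec.lookup (# 0 ∷ # 3 ∷ # 1 ∷ # 4 ∷ # 5 ∷ # 2 ∷ [])

off : ∀ t → Dir t → V
off sq  = Vec.lookup ((+ 0 , + 0) ∷ (+ 1 , + 1) ∷ (+ 1 , + 0) ∷ (+ 0 , + 1) ∷ [])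
off tri = Vec.lookup ((+ 0 , + 0) ∷ (+ 1 , + 0) ∷ (+ 1 , ℤ.- + 1) ∷ (+ 0 , + 1) ∷ (+ 0 , + 0) ∷ (+ 1 , + 0) ∷ [])
off hex = Vec.lookup ((+ 0 , ℤ.- + 1) ∷ (+ 0 , + 1) ∷ (+ 1 , ℤ.- + 1) ∷ (ℤ.- + 1 , + 1) ∷ (ℤ.- + 1 , + 0) ∷ (+ 1 , + 0) ∷ [])

ring : ∀ t → Dir t → List (Dir t)
ring t d = iterate (next t) d (sides t)

-- From the base point of a face to that of the face across its side d.
δ : ∀ t → Dir t → V
δ t d = off t (next t d) ⊖ off t (op t d)

-- The colour of the face with base point b and side d is lin b + κ d modulo k + 1.
lin : Tiling → V → ℤ
lin tri (a , b) = + 2 ℤ.* a ℤ.+ b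
lin sq  (a , b) = a ℤ.+ + 2 ℤ.* b
lin hex (a , b) = + 6 ℤ.* a ℤ.+ + 2 ℤ.* b

κ : ∀ t → Dir t → ℤ
κ tri = Vec.lookup (+ 0 ∷ + 2 ∷ + 2 ∷ + 0 ∷ + 2 ∷ + 0 ∷ [])
κ sq  _ = + 0
κ hex _ = + 0

shift : ∀ m → Fin (suc m) → ℤ → Fin (suc m)
shift m r w = residue m (+ toℕ r ℤ.+ w)

-- The colour of the face across side `d`, relative to `lin` of the original base point: the base
-- point moves by `δ`, and the reversed side brings its own `κ`.
κ′ : ∀ t → Dir t → ℤ
κ′ t d = lin t (δ t d) ℤ.+ κ t (op t d)

-- Whether points of a given class a − b mod 3 are vertices.
latᶜ : Tiling → Fin 3 → Bool
latᶜ hex r = not (toℕ r ℕ.≡ᵇ 2)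
latᶜ _   _ = true

class : V → ℤ
class (a , b) = a ℤ.- b

-- Local facts about the three tilings, decided by evaluation

module _ (P : Tiling → Set) (P? : ∀ t → Dec (P t)) where
  by-check : {True (P? tri)} → {True (P? sq)} → {True (P? hex)} → ∀ t → P t
  by-check {p} tri = toWitness p
  by-check {_} {p} sq = toWitness p
  by-check {_} {_} {p} hex = toWitness p

off-next : ∀ t d → off t (next t d) ≡ off t d ⊕ step t d
off-next = by-check _ λ t → all? λ d → off t (next t d) ≟V off t d ⊕ step t d

δ-op : ∀ t d → δ t d ⊕ off t (op t d) ≡ off t (next t d)
δ-op t d = ⊖-⊕ (off t (next t d)) (off t (op t d))

δ-next-op : ∀ t d → δ t d ⊕ off t (next t (op t d)) ≡ off t d
δ-next-op = by-check _ λ t → all? λ d → δ t d ⊕ off t (next t (op t d)) ≟V off t d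

step-injective : ∀ t d e → step t d ≡ step t e → d ≡ e
step-injective = by-check _ λ t → all? λ d → all? λ e → (step t d ≟V step t e) →-dec (d Finₚ.≟ e)

step-op : ∀ t d → step t d ⊕ step t (op t d) ≡ 𝟎
step-op = by-check _ λ t → all? λ d → step t d ⊕ step t (op t d) ≟V 𝟎

rep-rep : ∀ t d → rep t (rep t d) ≡ rep t d
rep-rep = by-check _ λ t → all? λ d → rep t (rep t d) Finₚ.≟ rep t d

rep-next : ∀ t d → rep t (next t d) ≡ rep t d
rep-next = by-check _ λ t → all? λ d → rep t (next t d) Finₚ.≟ rep t d

ring-rep : ∀ t d → All (λ e → rep t e ≡ rep t d) (ring t d)
ring-rep = by-check _ λ t → all? λ d → All.all? (λ e → rep t e Finₚ.≟ rep t d) (ring t d)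

infix 4 _∈?_
_∈?_ : ∀ {n} (d : Fin n) xs → Dec (d ∈ xs)
d ∈? xs = Any.any? (d Finₚ.≟_) xs

ring-complete : ∀ t d e → rep t e ≡ rep t d → e ∈ ring t d
ring-complete = by-check _ λ t → all? λ d → all? λ e → (rep t e Finₚ.≟ rep t d) →-dec (e ∈? ring t d)

repPos-injective : ∀ t d e → rep t d ≡ rep t e → pos t d ≡ pos t e → d ≡ e
repPos-injective = by-check _ λ t → all? λ d → all? λ e →
  (rep t d Finₚ.≟ rep t e) →-dec (pos t d Finₚ.≟ pos t e) →-dec (d Finₚ.≟ e)

pos-surjective : ∀ t d i → ∃[ e ] rep t e ≡ rep t d × pos t e ≡ i
pos-surjective = by-check _ λ t → all? λ d → all? λ i → any? λ e → (rep t e Finₚ.≟ rep t d) ×-dec (pos t e Finₚ.≟ i)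

rot-ring : ∀ t d → rot (ring t d) ≡ map (next t) (ring t d)
rot-ring = by-check _ λ t → all? λ d → Listₚ.≡-dec Finₚ._≟_ (rot (ring t d)) (map (next t) (ring t d))

ring-off-unique : ∀ t d → Unique (map (off t) (ring t d))
ring-off-unique = by-check _ λ t → all? λ d → AllPairs.allPairs? (λ u v → ¬? (u ≟V v)) (map (off t) (ring t d))

κ-rep : ∀ t d → κ t (rep t d) ≡ κ t d
κ-rep = by-check _ λ t → all? λ d → κ t (rep t d) ℤ.≟ κ t d

-- For squares the values of `κ′` are ±1, ±2 modulo 5, for hexagons ±1, ±2, ±3 modulo 7. For either
-- shape of triangle they are the three residues modulo 4 other than its `κ`.
rainbow : ∀ t r d e → rep t d ≡ rep t e →
  shift (sides t) r (κ′ t d) ≡ shift (sides t) r (κ′ t e) → d ≡ e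
rainbow = by-check _ λ t → all? λ r → all? λ d → all? λ e → (rep t d Finₚ.≟ rep t e) →-dec
  (shift (sides t) r (κ′ t d) Finₚ.≟ shift (sides t) r (κ′ t e)) →-dec (d Finₚ.≟ e)

rainbow-centre : ∀ t r d → shift (sides t) r (κ t d) ≢ shift (sides t) r (κ′ t d)
rainbow-centre = by-check _ λ t → all? λ r → all? λ d → ¬? (shift (sides t) r (κ t d) Finₚ.≟ shift (sides t) r (κ′ t d))

all-colours : ∀ t r j d → shift (sides t) r (κ t d) ≡ j ⊎
  ∃[ e ] rep t e ≡ rep t d × shift (sides t) r (κ′ t e) ≡ j
all-colours = by-check _ λ t → all? λ r → all? λ j → all? λ d → (shift (sides t) r (κ t d) Finₚ.≟ j) ⊎-dec
  any? λ e → (rep t e Finₚ.≟ rep t d) ×-dec (shift (sides t) r (κ′ t e) Finₚ.≟ j)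

-- In the hexagonal case the six neighbours of a lattice point alternate between the two classes
-- other than its own. If two consecutive ones are vertices, the point is in the deleted class, so
-- all six are vertices.
lat-edge⇒ring : ∀ t r d e → rep t e ≡ rep t d → T (latᶜ t (shift 2 r (class (off t d)))) →
  T (latᶜ t (shift 2 r (class (off t (next t d))))) → T (latᶜ t (shift 2 r (class (off t e))))
lat-edge⇒ring = by-check _ λ t → all? λ r → all? λ d → all? λ e → (rep t e Finₚ.≟ rep t d) →-dec
  T? (latᶜ t (shift 2 r (class (off t d)))) →-dec T? (latᶜ t (shift 2 r (class (off t (next t d))))) →-dec
  T? (latᶜ t (shift 2 r (class (off t e))))

-- Flags: darts together with the face on their left

Flag : Tiling → Set
Flag t = V × Dir t

edge : ∀ t → Flag t → V × V
edge t (b , d) = b ⊕ off t d , b ⊕ off t (next t d)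

opp : ∀ t → Flag t → Flag t
opp t (b , d) = b ⊕ δ t d , op t d

flag : ∀ t → V → Dir t → Flag t
flag t v d = v ⊖ off t d , d

colour : ∀ t → Flag t → Fin (suc (sides t))
colour t (b , d) = residue (sides t) (lin t b ℤ.+ κ t d)

lat : Tiling → V → Bool
lat t v = latᶜ t (residue 2 (class v))

edge-step : ∀ t b d → proj₂ (edge t (b , d)) ≡ proj₁ (edge t (b , d)) ⊕ step t d
edge-step t b d = trans (cong (b ⊕_) (off-next t d)) (sym (⊕-assoc b (off t d) (step t d)))

edge-flag : ∀ t v d → edge t (flag t v d) ≡ (v , v ⊕ step t d)
edge-flag t v d = cong₂ _,_ (⊖-⊕ v (off t d))
  (trans (edge-step t (v ⊖ off t d) d) (cong (_⊕ step t d) (⊖-⊕ v (off t d))))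

-- The displacement of a dart gives its direction, and the start then gives the base point; so a
-- dart has only one face on its left.
edge-injective : ∀ t {x y} → edge t x ≡ edge t y → x ≡ y
edge-injective t {b , d} {c , e} eq
  with step-injective t d e (⊕-cancelˡ (b ⊕ off t d)
    (trans (sym (edge-step t b d)) (trans (cong proj₂ eq)
      (trans (edge-step t c e) (cong (_⊕ step t e) (sym (cong proj₁ eq)))))))
... | refl = cong (_, d) (⊕-cancelʳ (off t d) (cong proj₁ eq))

edge-opp : ∀ t x → edge t (opp t x) ≡ (proj₂ (edge t x) , proj₁ (edge t x))
edge-opp t (b , d) = cong₂ _,_
  (trans (⊕-assoc b _ _) (cong (b ⊕_) (δ-op t d)))
  (trans (⊕-assoc b _ _) (cong (b ⊕_) (δ-next-op t d)))

sameEdge⇒flag : ∀ t {x y} → SameEdge (edge t x) (edge t y) → y ≡ x ⊎ y ≡ opp t x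
sameEdge⇒flag t {x} {y} (inj₁ (p , q)) = inj₁ (sym (edge-injective t (cong₂ _,_ p q)))
sameEdge⇒flag t {x} {y} (inj₂ (p , q)) = inj₂ (sym (edge-injective t (trans (edge-opp t x) (cong₂ _,_ q p))))

sameEdge-opp : ∀ t x → SameEdge (edge t (opp t x)) (edge t x)
sameEdge-opp t x = inj₂ (cong proj₁ (edge-opp t x) , cong proj₂ (edge-opp t x))

class-⊕ : ∀ u v → class (u ⊕ v) ≡ class u ℤ.+ class v
class-⊕ (a , b) (c , d) = lemma a b c d
  where
  lemma : ∀ a b c d → (a ℤ.+ c) ℤ.- (b ℤ.+ d) ≡ (a ℤ.- b) ℤ.+ (c ℤ.- d)
  lemma = solve-∀

lat-⊕ : ∀ t u v → lat t (u ⊕ v) ≡ latᶜ t (shift 2 (residue 2 (class u)) (class v))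
lat-⊕ t u v = cong (latᶜ t) (trans (cong (residue 2) (class-⊕ u v)) (residue-+ 2 (class u) (class v)))

lin-⊕ : ∀ t u v → lin t (u ⊕ v) ≡ lin t u ℤ.+ lin t v
lin-⊕ tri (a , b) (c , d) = lemma a b c d
  where
  lemma : ∀ a b c d → + 2 ℤ.* (a ℤ.+ c) ℤ.+ (b ℤ.+ d) ≡ (+ 2 ℤ.* a ℤ.+ b) ℤ.+ (+ 2 ℤ.* c ℤ.+ d)
  lemma = solve-∀
lin-⊕ sq (a , b) (c , d) = lemma a b c d
  where
  lemma : ∀ a b c d → (a ℤ.+ c) ℤ.+ + 2 ℤ.* (b ℤ.+ d) ≡ (a ℤ.+ + 2 ℤ.* b) ℤ.+ (c ℤ.+ + 2 ℤ.* d)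
  lemma = solve-∀
lin-⊕ hex (a , b) (c , d) = lemma a b c d
  where
  lemma : ∀ a b c d → + 6 ℤ.* (a ℤ.+ c) ℤ.+ + 2 ℤ.* (b ℤ.+ d) ≡ (+ 6 ℤ.* a ℤ.+ + 2 ℤ.* b) ℤ.+ (+ 6 ℤ.* c ℤ.+ + 2 ℤ.* d)
  lemma = solve-∀

base-colour : ∀ t → V → Fin (suc (sides t))
base-colour t b = residue (sides t) (lin t b)

colour-shift : ∀ t b d → colour t (b , d) ≡ shift (sides t) (base-colour t b) (κ t d)
colour-shift t b d = residue-+ (sides t) (lin t b) (κ t d)

colour-opp : ∀ t b d → colour t (opp t (b , d)) ≡ shift (sides t) (base-colour t b) (κ′ t d)
colour-opp t b d = trans (cong (residue (sides t)) (trans (cong (ℤ._+ κ t (op t d)) (lin-⊕ t b (δ t d)))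
  (ℤₚ.+-assoc (lin t b) (lin t (δ t d)) (κ t (op t d))))) (residue-+ (sides t) (lin t b) (κ′ t d))

colour-rep : ∀ t b d → colour t (b , rep t d) ≡ colour t (b , d)
colour-rep t b d = cong (λ w → residue (sides t) (lin t b ℤ.+ w)) (κ-rep t d)

colour-face : ∀ t b {d e} → rep t d ≡ rep t e → colour t (b , d) ≡ colour t (b , e)
colour-face t b {d} {e} same = trans (sym (colour-rep t b d)) (trans (cong (λ r → colour t (b , r)) same) (colour-rep t b e))

lat-face : ∀ t b d e → rep t e ≡ rep t d →
  T (lat t (proj₁ (edge t (b , d)))) → T (lat t (proj₂ (edge t (b , d)))) → T (lat t (b ⊕ off t e))
lat-face t b d e same l₁ l₂ = subst T (sym (lat-⊕ t b (off t e)))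
  (lat-edge⇒ring t (residue 2 (class b)) d e same (subst T (lat-⊕ t b (off t d)) l₁) (subst T (lat-⊕ t b (off t (next t d))) l₂))

SameFace : ∀ t → Flag t → Flag t → Set
SameFace t (b , d) (c , e) = b ≡ c × rep t d ≡ rep t e

SameFace-trans : ∀ t {x y z} → SameFace t x y → SameFace t y z → SameFace t x z
SameFace-trans t (refl , p) (refl , q) = refl , trans p q

SameFace-sym : ∀ t {x y} → SameFace t x y → SameFace t y x
SameFace-sym t (refl , p) = refl , sym p

neighbour-unique : ∀ t {b d e} → rep t d ≡ rep t e →
  colour t (opp t (b , d)) ≡ colour t (opp t (b , e)) → d ≡ e
neighbour-unique t {b} {d} {e} same eq = rainbow t (base-colour t b) d e same
  (trans (sym (colour-opp t b d)) (trans eq (colour-opp t b e)))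

-- This is also why a colour class is edge-disjoint: faces on the two sides of an edge differ in
-- colour.
neighbour≢centre : ∀ t b {d e} → rep t d ≡ rep t e → colour t (b , d) ≢ colour t (opp t (b , e))
neighbour≢centre t b {d} {e} same eq = rainbow-centre t (base-colour t b) e
  (trans (sym (colour-shift t b e)) (trans (sym (colour-face t b same)) (trans eq (colour-opp t b e))))

colour-dominates : ∀ t b d j → colour t (b , d) ≡ j ⊎ ∃[ e ] rep t e ≡ rep t d × colour t (opp t (b , e)) ≡ j
colour-dominates t b d j with all-colours t (base-colour t b) j d
... | inj₁ eq = inj₁ (trans (colour-shift t b d) eq)
... | inj₂ (e , same , eq) = inj₂ (e , same , trans (colour-opp t b e) eq)

zip-map : ∀ {A B C : Set} (f : A → B) (g : A → C) xs → zip (map f xs) (map g xs) ≡ map (λ x → f x , g x) xs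
zip-map f g [] = refl
zip-map f g (x ∷ xs) = cong (_ ∷_) (zip-map f g xs)

rot-map : ∀ {A B : Set} (f : A → B) xs → rot (map f xs) ≡ map f (rot xs)
rot-map f [] = refl
rot-map f (x ∷ xs) = sym (Listₚ.map-++ f xs [ x ])

corners : ∀ t → Flag t → List V
corners t (b , d) = map (λ e → b ⊕ off t e) (ring t d)

cycEdges-corners : ∀ t b d → cycEdges (corners t (b , d)) ≡ map (λ e → edge t (b , e)) (ring t d)
cycEdges-corners t b d = begin
  zip (corners t (b , d)) (rot (corners t (b , d)))
    ≡⟨ cong (zip _) (trans (rot-map (λ e → b ⊕ off t e) (ring t d)) (trans (cong (map _) (rot-ring t d)) (sym (Listₚ.map-∘ (ring t d))))) ⟩
  zip (corners t (b , d)) (map (λ e → b ⊕ off t (next t e)) (ring t d))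
    ≡⟨ zip-map _ _ (ring t d) ⟩
  map (λ e → edge t (b , e)) (ring t d) ∎
  where open ≡-Reasoning

T-∧ : ∀ {x y} → T x → T y → T (x ∧ y)
T-∧ {true} {true} _ _ = tt

T-∧⁻ : ∀ {x y} → T (x ∧ y) → T x × T y
T-∧⁻ {true} {true} _ = tt , tt

==-refl : ∀ x → T (x == x)
==-refl x with x ℤ.≟ x
... | yes _ = tt
... | no ¬e = ¬e refl

==-sound : ∀ {x y} → T (x == y) → x ≡ y
==-sound {x} {y} p with x ℤ.≟ y
... | yes e = e

adj-step : ∀ t v d → T (adj t v (v ⊕ step t d))
adj-step t v@(a , b) d = Anyₚ.any⁺ _ (lose (∈-lookup {xs = steps t} d)
  (T-∧ (subst (λ x → T (x == proj₁ (step t d))) (sym (lemma a _)) (==-refl (proj₁ (step t d))))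
       (subst (λ x → T (x == proj₂ (step t d))) (sym (lemma b _)) (==-refl (proj₂ (step t d))))))
  where
  lemma : ∀ x y → x ℤ.+ y ℤ.- x ≡ y
  lemma = solve-∀

adj-sound : ∀ t u v → T (adj t u v) → ∃[ d ] v ≡ u ⊕ step t d
adj-sound t u@(a , b) v@(c , d) p with find (Anyₚ.any⁻ _ (steps t) p)
... | s , s∈ , q with T-∧⁻ q
... | q₁ , q₂ = Any.index s∈ , cong₂ _,_
      (trans (lemma a c) (cong (λ z → a ℤ.+ z) (trans (==-sound q₁) (cong proj₁ (Anyₚ.lookup-index s∈)))))
      (trans (lemma b d) (cong (λ z → b ℤ.+ z) (trans (==-sound q₂) (cong proj₂ (Anyₚ.lookup-index s∈)))))
  where
  lemma : ∀ x y → y ≡ x ℤ.+ (y ℤ.- x)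
  lemma = solve-∀

InRegion : ∀ t → ℕ → Flag t → Set
InRegion t n x = All (λ v → T (inR t n v)) (corners t x)

module _ {t : Tiling} {n : ℕ} where
  InRegion-edge : ∀ b d e → rep t e ≡ rep t d → InRegion t n (b , d) →
    T (adjR t n (proj₁ (edge t (b , e))) (proj₂ (edge t (b , e))))
  InRegion-edge b d e same ins = T-∧ (corner e same) (T-∧ (corner (next t e) (trans (rep-next t e) same))
    (subst (λ v → T (adj t (b ⊕ off t e) v)) (sym (edge-step t b e)) (adj-step t (b ⊕ off t e) e)))
    where
    corner : ∀ e → rep t e ≡ rep t d → T (inR t n (b ⊕ off t e))
    corner e same = All.lookup ins (∈-map⁺ _ (ring-complete t d e same))

  faceCopy : ∀ x → InRegion t n x → Copy t n
  faceCopy x ins .verts = corners t x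
  faceCopy (b , d) ins .len = trans (Listₚ.length-map _ (ring t d)) (Listₚ.length-iterate (next t) d (sides t))
  faceCopy x ins .inside = ins
  faceCopy (b , d) ins .distinct = subst Unique (sym (Listₚ.map-∘ (ring t d)))
    (Uniqueₚ.map⁺ (⊕-cancelˡ b) (ring-off-unique t d))
  faceCopy (b , d) ins .adjacent = subst (All _) (sym (cycEdges-corners t b d))
    (Allₚ.map⁺ (All.tabulate λ {e} e∈ → InRegion-edge b d e (All.lookup (ring-rep t d) e∈) ins))

  faceCopy-edge⁺ : ∀ {b d} ins e → rep t e ≡ rep t d → edge t (b , e) ∈ cycEdges (verts (faceCopy (b , d) ins))
  faceCopy-edge⁺ {b} {d} ins e same = subst (edge t (b , e) ∈_) (sym (cycEdges-corners t b d))
    (∈-map⁺ _ (ring-complete t d e same))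

  faceCopy-edge⁻ : ∀ {b d} ins {f} → f ∈ cycEdges (verts (faceCopy (b , d) ins)) →
    ∃[ e ] rep t e ≡ rep t d × f ≡ edge t (b , e)
  faceCopy-edge⁻ {b} {d} ins {f} f∈ with ∈-map⁻ _ (subst (f ∈_) (cycEdges-corners t b d) f∈)
  ... | e , e∈ , eq = e , All.lookup (ring-rep t d) e∈ , eq

-- Cycles of length k

T-⇒ : ∀ {P : Set} {b} (P? : Dec P) → T (not (does P?) ∨ b) → P → T b
T-⇒ (yes _) ok _ = ok
T-⇒ (no ¬p) _ p = contradiction p ¬p

T-does : ∀ {P : Set} (P? : Dec P) → T (does P?) → P
T-does (yes p) _ = p

dartEdges : ∀ t → V → List (Dir t) → List (V × V)
dartEdges t v [] = []
dartEdges t v (d ∷ ds) = (v , v ⊕ step t d) ∷ dartEdges t (v ⊕ step t d) ds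

total : ∀ t → List (Dir t) → V
total t [] = 𝟎
total t (d ∷ ds) = step t d ⊕ total t ds

module _ (t : Tiling) where
  -- The closing vertex `w` is kept apart from the start so that the induction can move the start
  -- along. For a cycle the two coincide, which forces `total` to vanish.
  decode : ∀ u us w → All (λ e → T (adj t (proj₁ e) (proj₂ e))) (zip (u ∷ us) (us ++ [ w ])) →
    ∃[ ds ] zip (u ∷ us) (us ++ [ w ]) ≡ dartEdges t u ds × length ds ≡ suc (length us) ×
            w ≡ u ⊕ total t ds × u ∷ us ≡ map proj₁ (dartEdges t u ds)
  decode u [] w (a ∷ []) with adj-sound t u w a
  ... | d , refl = d ∷ [] , refl , refl , cong (u ⊕_) (sym (⊕-identityʳ (step t d))) , refl
  decode u (v ∷ us) w (a ∷ as) with adj-sound t u v a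
  ... | d , refl with decode (u ⊕ step t d) us w as
  ... | ds , edges , len , end , verts = d ∷ ds , cong (_ ∷_) edges , cong suc len ,
        trans end (⊕-assoc u (step t d) (total t ds)) , cong (u ∷_) verts

  -- A condition on two consecutive steps alone, used to prune the search. The class `r` of the
  -- first vertex is chosen anew at each turn, which can only admit more walks.
  Turn : Dir t → Dir t → Set
  Turn d e = e ≢ op t d × ∃[ r ] T (latᶜ t r) × T (latᶜ t (shift 2 r (class (step t d)))) ×
    T (latᶜ t (shift 2 r (class (step t d ⊕ step t e))))

  turn? : ∀ d e → Dec (Turn d e)
  turn? d e = ¬? (e Finₚ.≟ op t d) ×-dec any? λ r → T? (latᶜ t r) ×-dec
    T? (latᶜ t (shift 2 r (class (step t d)))) ×-dec T? (latᶜ t (shift 2 r (class (step t d ⊕ step t e))))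

  -- The last step is left free: it returns to the start, so its end is not a further entry of the
  -- list of distinct vertices.
  Turns : List (Dir t) → Set
  Turns (d ∷ ds@(e ∷ _ ∷ _)) = Turn d e × Turns ds
  Turns _ = ⊤

  walk-turns : ∀ v ds → Unique (map proj₁ (dartEdges t v ds)) →
    All (λ v → T (lat t v)) (map proj₁ (dartEdges t v ds)) → Turns ds
  walk-turns v [] _ _ = tt
  walk-turns v (d ∷ []) _ _ = tt
  walk-turns v (d ∷ e ∷ []) _ _ = tt
  walk-turns v (d ∷ ds@(e ∷ f ∷ _)) ((_ ∷ v≢v′ ∷ _) ∷ u) (l₀ ∷ ls@(l₁ ∷ l₂ ∷ _)) =
    (no-backtrack , residue 2 (class v) , l₀ , subst T (lat-⊕ t v _) l₁ ,
      subst T (lat-⊕ t v _) (subst (λ w → T (lat t w)) (⊕-assoc v _ _) l₂)) ,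
    walk-turns (v ⊕ step t d) ds u ls
    where
    no-backtrack : e ≢ op t d
    no-backtrack refl = v≢v′ (sym (trans (⊕-assoc v _ _) (trans (cong (v ⊕_) (step-op t d)) (⊕-identityʳ v))))

  -- A search on bare truth values, whose soundness is proved separately; `Q` absorbs the directions
  -- already chosen.
  allWalks : ℕ → Dir t → (List (Dir t) → Bool) → Bool
  allWalks zero d Q = Q [ d ]
  allWalks (suc zero) d Q = all (λ e → Q (d ∷ e ∷ [])) (allFin _)
  allWalks (suc (suc m)) d Q = all (λ e → not (does (turn? d e)) ∨ allWalks (suc m) e (Q ∘ (d ∷_))) (allFin _)

  allWalks-sound : ∀ m d Q → T (allWalks m d Q) → ∀ ds → length ds ≡ m → Turns (d ∷ ds) → T (Q (d ∷ ds))
  allWalks-sound zero d Q ok [] refl _ = ok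
  allWalks-sound (suc zero) d Q ok (e ∷ []) refl _ = All.lookup (Allₚ.all⁺ _ _ ok) (∈-allFin e)
  allWalks-sound (suc (suc m)) d Q ok (e ∷ f ∷ ds) refl (turn , turns)
    = allWalks-sound (suc m) e (Q ∘ (d ∷_))
        (T-⇒ (turn? d e) (All.lookup (Allₚ.all⁺ _ _ ok) (∈-allFin e)) turn) (f ∷ ds) refl turns

  -- Inclusion both ways and up to orientation, since a copy may start at any corner and run either
  -- way round its face.
  SameEdges : List (V × V) → Flag t → Set
  SameEdges es (b , d) = All (λ e → Any (λ c → SameEdge e (edge t (b , c))) (ring t d)) es ×
                         All (λ c → Any (SameEdge (edge t (b , c))) es) (ring t d)

  sameEdges? : ∀ es x → Dec (SameEdges es x)
  sameEdges? es (b , d) = All.all? (λ e → Any.any? (λ c → sameEdge? e (edge t (b , c))) (ring t d)) es ×-dec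
                          All.all? (λ c → Any.any? (sameEdge? (edge t (b , c))) es) (ring t d)

  -- The face in question lies to the left or to the right of the first dart.
  Bounds : List (Dir t) → Set
  Bounds [] = ⊥
  Bounds ds@(d ∷ _) = SameEdges (dartEdges t 𝟎 ds) (flag t 𝟎 d) ⊎ SameEdges (dartEdges t 𝟎 ds) (opp t (flag t 𝟎 d))

  closed⇒bounds? : ∀ ds → Dec (total t ds ≡ 𝟎 → Bounds ds)
  closed⇒bounds? [] = no λ b → b refl
  closed⇒bounds? ds@(d ∷ _) = (total t ds ≟V 𝟎) →-dec (sameEdges? _ (flag t 𝟎 d) ⊎-dec sameEdges? _ (opp t (flag t 𝟎 d)))

-- This is the fact that every k-cycle bounds a face, by exhaustion over walks from the origin with
-- a given first dart.
short-cycles-check : ∀ t d → T (allWalks t (ℕ.pred (sides t)) d (does ∘ closed⇒bounds? t))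
short-cycles-check = by-check _ λ t → all? λ d → T? (allWalks t (ℕ.pred (sides t)) d (does ∘ closed⇒bounds? t))

translate : V → V × V → V × V
translate v (x , y) = v ⊕ x , v ⊕ y

module _ (t : Tiling) where
  dartEdges-translate : ∀ v w ds → dartEdges t (v ⊕ w) ds ≡ map (translate v) (dartEdges t w ds)
  dartEdges-translate v w [] = refl
  dartEdges-translate v w (d ∷ ds) rewrite ⊕-assoc v w (step t d) =
    cong (_ ∷_) (dartEdges-translate v (w ⊕ step t d) ds)

  edge-translate : ∀ v b d → edge t (v ⊕ b , d) ≡ translate v (edge t (b , d))
  edge-translate v b d = cong₂ _,_ (⊕-assoc v b _) (⊕-assoc v b _)

  sameEdge-translate : ∀ v {e f} → SameEdge e f → SameEdge (translate v e) (translate v f)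
  sameEdge-translate v (inj₁ (refl , refl)) = inj₁ (refl , refl)
  sameEdge-translate v (inj₂ (refl , refl)) = inj₂ (refl , refl)

  sameEdges-translate : ∀ v es b d → SameEdges t es (b , d) → SameEdges t (map (translate v) es) (v ⊕ b , d)
  sameEdges-translate v es b d (p , q) =
    Allₚ.map⁺ (All.map (λ {e} → Any.map λ {c} same →
      subst (SameEdge (translate v e)) (sym (edge-translate v b c)) (sameEdge-translate v same)) p) ,
    All.map (λ {c} any → Anyₚ.map⁺ (Any.map (λ {e} same →
      subst (λ f → SameEdge f (translate v e)) (sym (edge-translate v b c)) (sameEdge-translate v same)) any)) q

  -- `Bounds` compares positions only and does not mention deleted points, so the check at the
  -- origin may be translated by any vector.
  bounds-face : ∀ v ds → Bounds t ds → ∃[ x ] SameEdges t (dartEdges t v ds) x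
  bounds-face v ds@(d ∷ _) bounds = go bounds
    where
    at-v : dartEdges t v ds ≡ map (translate v) (dartEdges t 𝟎 ds)
    at-v = trans (cong (λ w → dartEdges t w ds) (sym (⊕-identityʳ v))) (dartEdges-translate v 𝟎 ds)
    place : ∀ x → SameEdges t (dartEdges t 𝟎 ds) x → ∃[ x ] SameEdges t (dartEdges t v ds) x
    place (b , e) s = (v ⊕ b , e) , subst (λ es → SameEdges t es (v ⊕ b , e)) (sym at-v) (sameEdges-translate v _ b e s)
    go : Bounds t ds → _
    go (inj₁ s) = place (flag t 𝟎 d) s
    go (inj₂ s) = place (opp t (flag t 𝟎 d)) s

lat-inR : ∀ t n v → T (inR t n v) → T (lat t v)
lat-inR tri n v _ = tt
lat-inR sq  n v _ = tt
lat-inR hex n v@(a , b) p = subst (λ r → T (not (r ℕ.≡ᵇ 2))) (sym (Finₚ.toℕ-fromℕ< (n%ℕd<d (a ℤ.- b) 3)))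
  (proj₂ (T-∧⁻ {inR tri n v} p))

copy-face : ∀ {t n} (C : Copy t n) → ∃[ x ] SameEdges t (cycEdges (verts C)) x
copy-face {t} {n} C = go (verts C) (len C) (inside C) (distinct C) (adjacent C)
  where
  go : ∀ vs → length vs ≡ sides t → All (λ v → T (inR t n v)) vs → Unique vs →
       All (λ e → T (adjR t n (proj₁ e) (proj₂ e))) (cycEdges vs) → ∃[ x ] SameEdges t (cycEdges vs) x
  go [] e _ _ _ = contradiction e (nonempty t)
    where
    nonempty : ∀ t → 0 ≢ sides t
    nonempty tri ()
    nonempty sq ()
    nonempty hex ()
  go (v ∷ vs) e ins uniq adjs
    with decode t v vs v (All.map (λ {e} a → proj₂ (T-∧⁻ {inR t n (proj₂ e)} (proj₂ (T-∧⁻ {inR t n (proj₁ e)} a)))) adjs)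
  ... | d ∷ ds , edges , l , end , path rewrite edges = bounds-face t v (d ∷ ds)
        (bounded (allWalks-sound t _ d _ (short-cycles-check t d) ds
           (cong ℕ.pred (trans l e))
           (walk-turns t v (d ∷ ds) (subst Unique path uniq) (All.map (λ {v} → lat-inR t n v) (subst (All _) path ins)))))
    where
    bounded : T (does (closed⇒bounds? t (d ∷ ds))) → Bounds t (d ∷ ds)
    bounded ok = T-does (closed⇒bounds? t (d ∷ ds)) ok (⊕-cancelˡ v (trans (sym end) (sym (⊕-identityʳ v))))

-- The boundary of the region

-- The window alone, with the hexagon centres restored: unlike the vertex set it is convex along the
-- rows and columns of the lattice.
Region : Tiling → ℕ → V → Set
Region sq n (a , b) = + 0 ℤ.≤ a × a ℤ.+ + 1 ℤ.≤ + n × + 0 ℤ.≤ b × b ℤ.+ + 1 ℤ.≤ + n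
Region _  n (a , b) = + 0 ℤ.≤ b × + 3 ℤ.* b ℤ.* b ℤ.+ + 1 ℤ.≤ + 4 ℤ.* + n ℤ.* + n ×
                      + 0 ℤ.≤ + 2 ℤ.* a ℤ.+ b × + 2 ℤ.* a ℤ.+ b ℤ.+ + 1 ℤ.≤ + 2 ℤ.* + n

region? : ∀ t n v → Dec (Region t n v)
region? sq n (a , b) = (_ ℤₚ.≤? _) ×-dec (_ ℤₚ.≤? _) ×-dec (_ ℤₚ.≤? _) ×-dec (_ ℤₚ.≤? _)
region? tri n (a , b) = (_ ℤₚ.≤? _) ×-dec (_ ℤₚ.≤? _) ×-dec (_ ℤₚ.≤? _) ×-dec (_ ℤₚ.≤? _)
region? hex n (a , b) = (_ ℤₚ.≤? _) ×-dec (_ ℤₚ.≤? _) ×-dec (_ ℤₚ.≤? _) ×-dec (_ ℤₚ.≤? _)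

∧⁴-sound : ∀ {i j k l i′ j′ k′ l′} → T ((i ℤ.≤ᵇ i′) ∧ (j ℤ.≤ᵇ j′) ∧ (k ℤ.≤ᵇ k′) ∧ (l ℤ.≤ᵇ l′)) →
  i ℤ.≤ i′ × j ℤ.≤ j′ × k ℤ.≤ k′ × l ℤ.≤ l′
∧⁴-sound p with T-∧⁻ p
... | p₁ , p with T-∧⁻ p
... | p₂ , p with T-∧⁻ p
... | p₃ , p₄ = ℤₚ.≤ᵇ⇒≤ p₁ , ℤₚ.≤ᵇ⇒≤ p₂ , ℤₚ.≤ᵇ⇒≤ p₃ , ℤₚ.≤ᵇ⇒≤ p₄

∧⁴-complete : ∀ {i j k l i′ j′ k′ l′} → i ℤ.≤ i′ × j ℤ.≤ j′ × k ℤ.≤ k′ × l ℤ.≤ l′ →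
  T ((i ℤ.≤ᵇ i′) ∧ (j ℤ.≤ᵇ j′) ∧ (k ℤ.≤ᵇ k′) ∧ (l ℤ.≤ᵇ l′))
∧⁴-complete (p₁ , p₂ , p₃ , p₄) = T-∧ (ℤₚ.≤⇒≤ᵇ p₁) (T-∧ (ℤₚ.≤⇒≤ᵇ p₂) (T-∧ (ℤₚ.≤⇒≤ᵇ p₃) (ℤₚ.≤⇒≤ᵇ p₄)))

inR⇒region : ∀ t n v → T (inR t n v) → Region t n v
inR⇒region tri n v p = ∧⁴-sound p
inR⇒region sq  n v p = ∧⁴-sound p
inR⇒region hex n v p = ∧⁴-sound (proj₁ (T-∧⁻ p))

region⇒inR : ∀ t n v → Region t n v → T (lat t v) → T (inR t n v)
region⇒inR tri n v p _ = ∧⁴-complete p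
region⇒inR sq  n v p _ = ∧⁴-complete p
region⇒inR hex n v@(a , b) p l = T-∧ (∧⁴-complete p)
  (subst (λ r → T (not (r ℕ.≡ᵇ 2))) (Finₚ.toℕ-fromℕ< (n%ℕd<d (a ℤ.- b) 3)) l)

pos-*-* : ∀ k m n → + k ℤ.* + m ℤ.* + n ≡ + (k * m * n)
pos-*-* k m n = trans (cong (ℤ._* + n) (sym (ℤₚ.pos-* k m))) (sym (ℤₚ.pos-* (k * m) n))

3*-mono : ∀ {x y} → + 0 ℤ.≤ x → x ℤ.≤ y → + 3 ℤ.* x ℤ.* x ℤ.≤ + 3 ℤ.* y ℤ.* y
3*-mono {+ x} {+ y} _ (ℤ.+≤+ x≤y) = subst₂ ℤ._≤_ (sym (pos-*-* 3 x x)) (sym (pos-*-* 3 y y))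
  (ℤ.+≤+ (ℕₚ.*-mono-≤ (ℕₚ.*-monoʳ-≤ 3 x≤y) x≤y))

2*-mono : ∀ {x y} z → x ℤ.≤ y → + 2 ℤ.* x ℤ.+ z ℤ.≤ + 2 ℤ.* y ℤ.+ z
2*-mono z x≤y = ℤₚ.+-monoˡ-≤ z (ℤₚ.*-monoˡ-≤-nonNeg (+ 2) x≤y)

row-convex : ∀ t n {a c x b} → Region t n (a , b) → Region t n (c , b) → a ℤ.≤ x → x ℤ.≤ c → Region t n (x , b)
row-convex sq n (p , _ , q) (_ , r , _) a≤x x≤c =
  ℤₚ.≤-trans p a≤x , ℤₚ.≤-trans (ℤₚ.+-monoˡ-≤ (+ 1) x≤c) r , q
row-convex tri n {b = b} (p , q , r , _) (_ , _ , _ , s) a≤x x≤c =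
  p , q , ℤₚ.≤-trans r (2*-mono b a≤x) , ℤₚ.≤-trans (ℤₚ.+-monoˡ-≤ (+ 1) (2*-mono b x≤c)) s
row-convex hex n {b = b} (p , q , r , _) (_ , _ , _ , s) a≤x x≤c =
  p , q , ℤₚ.≤-trans r (2*-mono b a≤x) , ℤₚ.≤-trans (ℤₚ.+-monoˡ-≤ (+ 1) (2*-mono b x≤c)) s

column-convex : ∀ t n {a b x d} → Region t n (a , b) → Region t n (a , d) → b ℤ.≤ x → x ℤ.≤ d → Region t n (a , x)
column-convex sq n (p , q , r , _) (_ , _ , _ , s) b≤x x≤d =
  p , q , ℤₚ.≤-trans r b≤x , ℤₚ.≤-trans (ℤₚ.+-monoˡ-≤ (+ 1) x≤d) s
column-convex tri n {a} (p , _ , q , _) (_ , r , _ , s) b≤x x≤d =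
  ℤₚ.≤-trans p b≤x , ℤₚ.≤-trans (ℤₚ.+-monoˡ-≤ (+ 1) (3*-mono (ℤₚ.≤-trans p b≤x) x≤d)) r ,
  ℤₚ.≤-trans q (ℤₚ.+-monoʳ-≤ (+ 2 ℤ.* a) b≤x) ,
  ℤₚ.≤-trans (ℤₚ.+-monoˡ-≤ (+ 1) (ℤₚ.+-monoʳ-≤ (+ 2 ℤ.* a) x≤d)) s
column-convex hex n {a} (p , _ , q , _) (_ , r , _ , s) b≤x x≤d =
  ℤₚ.≤-trans p b≤x , ℤₚ.≤-trans (ℤₚ.+-monoˡ-≤ (+ 1) (3*-mono (ℤₚ.≤-trans p b≤x) x≤d)) r ,
  ℤₚ.≤-trans q (ℤₚ.+-monoʳ-≤ (+ 2 ℤ.* a) b≤x) ,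
  ℤₚ.≤-trans (ℤₚ.+-monoˡ-≤ (+ 1) (ℤₚ.+-monoʳ-≤ (+ 2 ℤ.* a) x≤d)) s

Within : ℕ → ℤ → Set
Within n z = + 0 ℤ.≤ z ℤ.+ + (2 * n) × z ℤ.≤ + (2 * n)

region-bounded : ∀ t n {a b} → Region t n (a , b) → Within n a × Within n b × + 0 ℤ.≤ b
region-bounded sq n (0≤a , a<n , 0≤b , b<n) = (ℤₚ.+-mono-≤ 0≤a (ℤ.+≤+ z≤n) , below a<n) , (ℤₚ.+-mono-≤ 0≤b (ℤ.+≤+ z≤n) , below b<n) , 0≤b
  where
  below : ∀ {z} → z ℤ.+ + 1 ℤ.≤ + n → z ℤ.≤ + (2 * n)
  below z<n = ℤₚ.≤-trans (ℤₚ.≤-trans (ℤₚ.i≤i+j _ (+ 1)) z<n) (ℤ.+≤+ (ℕₚ.m≤m+n n _))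
region-bounded tri n {a} {b} (0≤b , 3b² , 0≤x , x<2n) = (lower a 0≤x , upper a x<2n) , (ℤₚ.+-mono-≤ 0≤b (ℤ.+≤+ z≤n) , b≤2n b 0≤b 3b²) , 0≤b
  where
  b≤2n : ∀ b → + 0 ℤ.≤ b → + 3 ℤ.* b ℤ.* b ℤ.+ + 1 ℤ.≤ + 4 ℤ.* + n ℤ.* + n → b ℤ.≤ + (2 * n)
  b≤2n (+ b) _ h with b ℕ.≤? 2 * n
  ... | yes le = ℤ.+≤+ le
  ... | no ¬le = contradiction (ℤₚ.drop‿+≤+ (subst₂ (λ x y → x ℤ.+ + 1 ℤ.≤ y) (pos-*-* 3 b b) (pos-*-* 4 n n) h))
    (ℕₚ.<⇒≱ (ℕₚ.≤-<-trans 4n²≤3b² (ℕₚ.≤-reflexive (sym (ℕₚ.+-comm (3 * b * b) 1)))))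
    where
    4n²≤3b² : 4 * n * n ≤ 3 * b * b
    4n²≤3b² = begin
      4 * n * n ≡⟨ square n ⟩
      2 * n * (2 * n) ≤⟨ ℕₚ.*-mono-≤ (ℕₚ.<⇒≤ (ℕₚ.≰⇒> ¬le)) (ℕₚ.<⇒≤ (ℕₚ.≰⇒> ¬le)) ⟩
      b * b ≤⟨ ℕₚ.*-monoˡ-≤ b (ℕₚ.m≤m+n b _) ⟩
      3 * b * b ∎
      where
      open ℕₚ.≤-Reasoning
      square : ∀ n → 4 * n * n ≡ 2 * n * (2 * n)
      square = ℕS.solve-∀
  lower : ∀ a → + 0 ℤ.≤ + 2 ℤ.* a ℤ.+ b → + 0 ℤ.≤ a ℤ.+ + (2 * n)
  lower (+ a) _ = ℤ.+≤+ z≤n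
  -- For negative `a`, dropping one of the two copies of `a` leaves `a + b`, and `b` is at most
  -- `2n`.
  lower a@(-[1+ _ ]) h = begin
    + 0 ≤⟨ h ⟩
    + 2 ℤ.* a ℤ.+ b ≡⟨ rearrange a b ⟩
    a ℤ.+ (b ℤ.+ a) ≤⟨ ℤₚ.+-monoʳ-≤ a (ℤₚ.+-monoʳ-≤ b ℤ.-≤+) ⟩
    a ℤ.+ (b ℤ.+ + 0) ≡⟨ cong (ℤ._+_ a) (ℤₚ.+-identityʳ b) ⟩
    a ℤ.+ b ≤⟨ ℤₚ.+-monoʳ-≤ a (b≤2n b 0≤b 3b²) ⟩
    a ℤ.+ + (2 * n) ∎
    where
    open ℤₚ.≤-Reasoning
    rearrange : ∀ x y → + 2 ℤ.* x ℤ.+ y ≡ x ℤ.+ (y ℤ.+ x)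
    rearrange = solve-∀
  upper : ∀ a → + 2 ℤ.* a ℤ.+ b ℤ.+ + 1 ℤ.≤ + 2 ℤ.* + n → a ℤ.≤ + (2 * n)
  upper -[1+ _ ] _ = ℤ.-≤+
  upper a@(+ _) h = begin
    a ≡⟨ ℤₚ.+-identityʳ a ⟨
    a ℤ.+ + 0 ≤⟨ ℤₚ.+-monoʳ-≤ a (ℤₚ.+-mono-≤ {+ 0} {a} (ℤ.+≤+ z≤n) (ℤₚ.+-mono-≤ {+ 0} {b} {+ 0} {+ 1} 0≤b (ℤ.+≤+ z≤n))) ⟩
    a ℤ.+ (a ℤ.+ (b ℤ.+ + 1)) ≡⟨ rearrange a b ⟩
    + 2 ℤ.* a ℤ.+ b ℤ.+ + 1 ≤⟨ h ⟩
    + 2 ℤ.* + n ≡⟨ ℤₚ.pos-* 2 n ⟨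
    + (2 * n) ∎
    where
    open ℤₚ.≤-Reasoning
    rearrange : ∀ x y → x ℤ.+ (x ℤ.+ (y ℤ.+ + 1)) ≡ + 2 ℤ.* x ℤ.+ y ℤ.+ + 1
    rearrange = solve-∀
region-bounded hex n r = region-bounded tri n r

-- The number of integers from `-2n` to `2n`, enough to index the rows or the columns that meet the
-- window.
width : ℕ → ℕ
width n = suc (2 * n + 2 * n)

within-≲ : ∀ n → Within n ≲ width n
within-≲ n .code {z} (lo , hi) = fromℕ< (s≤s (ℤₚ.drop‿+≤+ (subst (ℤ._≤ _) (sym (ℤₚ.0≤i⇒+∣i∣≡i lo)) (ℤₚ.+-monoˡ-≤ (+ (2 * n)) hi))))
within-≲ n .code-inj {x} {y} (lo , hi) (lo′ , hi′) e =
  trans (sym (cancel x _)) (trans (cong (ℤ._- + (2 * n)) same) (cancel y _))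
  where
  cancel : ∀ x y → x ℤ.+ y ℤ.- y ≡ x
  cancel = solve-∀
  same : x ℤ.+ + (2 * n) ≡ y ℤ.+ + (2 * n)
  same = trans (sym (ℤₚ.0≤i⇒+∣i∣≡i lo)) (trans (cong +_ (Finₚ.fromℕ<-injective _ _ _ _ e)) (ℤₚ.0≤i⇒+∣i∣≡i lo′))

i<j⇒i+1≤j : ∀ {i j} → i ℤ.< j → i ℤ.+ + 1 ℤ.≤ j
i<j⇒i+1≤j {i} i<j = subst (ℤ._≤ _) (ℤₚ.+-comm (+ 1) i) (ℤₚ.i<j⇒suc[i]≤j i<j)

i<j⇒i≤j-1 : ∀ {i j} → i ℤ.< j → i ℤ.≤ j ℤ.+ -[1+ 0 ]
i<j⇒i≤j-1 {i} {j} i<j = subst (ℤ._≤ _) (cancel i) (ℤₚ.+-monoˡ-≤ -[1+ 0 ] (i<j⇒i+1≤j i<j))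
  where
  cancel : ∀ i → i ℤ.+ + 1 ℤ.+ -[1+ 0 ] ≡ i
  cancel = solve-∀

-- By convexity a line leaves the region at most once in either direction.
exit-≲ : ∀ t n d → (λ v → Region t n v × ¬ Region t n (v ⊕ step sq d)) ≲ width n
exit-≲ t n d = ≲-map (λ {v} _ → coordinate d v) (λ {v} (r , _) → bounded d v r) (λ {v} {w} (r , ¬r) (s , ¬s) → unique d v w r ¬r s ¬s) (within-≲ n)
  where
  coordinate : Dir sq → V → ℤ
  coordinate zero (a , b) = b
  coordinate (suc zero) (a , b) = b
  coordinate _ (a , b) = a
  bounded : ∀ d v → Region t n v → Within n (coordinate d v)
  bounded zero v r = proj₁ (proj₂ (region-bounded t n r))
  bounded (suc zero) v r = proj₁ (proj₂ (region-bounded t n r))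
  bounded (suc (suc _)) v r = proj₁ (region-bounded t n r)
  right : ∀ {a b c} → Region t n (a , b) → ¬ Region t n ((a , b) ⊕ (+ 1 , + 0)) → Region t n (c , b) → ¬ a ℤ.< c
  right {a} {b} r ¬r s a<c = ¬r (subst (λ y → Region t n (a ℤ.+ + 1 , y)) (sym (ℤₚ.+-identityʳ b))
    (row-convex t n r s (ℤₚ.i≤i+j a (+ 1)) (i<j⇒i+1≤j a<c)))
  left : ∀ {a b c} → Region t n (a , b) → Region t n (c , b) → ¬ Region t n ((c , b) ⊕ (-[1+ 0 ] , + 0)) → ¬ a ℤ.< c
  left {a} {b} {c} r s ¬s a<c = ¬s (subst (λ y → Region t n (c ℤ.+ -[1+ 0 ] , y)) (sym (ℤₚ.+-identityʳ b))
    (row-convex t n r s (i<j⇒i≤j-1 a<c) (ℤₚ.i-j≤i c (+ 1))))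
  up : ∀ {a b d} → Region t n (a , b) → ¬ Region t n ((a , b) ⊕ (+ 0 , + 1)) → Region t n (a , d) → ¬ b ℤ.< d
  up {a} {b} r ¬r s b<d = ¬r (subst (λ x → Region t n (x , b ℤ.+ + 1)) (sym (ℤₚ.+-identityʳ a))
    (column-convex t n r s (ℤₚ.i≤i+j b (+ 1)) (i<j⇒i+1≤j b<d)))
  down : ∀ {a b d} → Region t n (a , b) → Region t n (a , d) → ¬ Region t n ((a , d) ⊕ (+ 0 , -[1+ 0 ])) → ¬ b ℤ.< d
  down {a} {b} {d} r s ¬s b<d = ¬s (subst (λ x → Region t n (x , d ℤ.+ -[1+ 0 ])) (sym (ℤₚ.+-identityʳ a))
    (column-convex t n r s (i<j⇒i≤j-1 b<d) (ℤₚ.i-j≤i d (+ 1))))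
  antisym : ∀ {x y} → ¬ x ℤ.< y → ¬ y ℤ.< x → x ≡ y
  antisym {x} {y} x≮y y≮x = ℤₚ.≤-antisym (ℤₚ.≮⇒≥ y≮x) (ℤₚ.≮⇒≥ x≮y)
  unique : ∀ d v w → Region t n v → ¬ Region t n (v ⊕ step sq d) → Region t n w → ¬ Region t n (w ⊕ step sq d) →
    coordinate d v ≡ coordinate d w → v ≡ w
  unique zero (a , b) (c , _) r ¬r s ¬s refl = cong (_, b) (antisym (right r ¬r s) (right s ¬s r))
  unique (suc zero) (a , b) (c , _) r ¬r s ¬s refl = cong (_, b) (antisym (left r s ¬s) (left s r ¬r))
  unique (suc (suc zero)) (a , b) (_ , c) r ¬r s ¬s refl = cong (a ,_) (antisym (up r ¬r s) (up s ¬s r))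
  unique (suc (suc (suc zero))) (a , b) (_ , c) r ¬r s ¬s refl = cong (a ,_) (antisym (down r s ¬s) (down s r ¬r))

-- If a path of unit steps ends outside, some step is the first to leave. Each step accounts for at
-- most `width n` points, since translating back along the path is injective.
escape-≲ : ∀ t n ds → (λ v → Region t n v × ¬ Region t n (v ⊕ total sq ds)) ≲ length ds * width n
escape-≲ t n [] .code {v} (r , ¬r) = contradiction (subst (Region t n) (sym (⊕-identityʳ v)) r) ¬r
escape-≲ t n [] .code-inj {v} (r , ¬r) = contradiction (subst (Region t n) (sym (⊕-identityʳ v)) r) ¬r
escape-≲ t n (d ∷ ds) = ≲-map (λ {v} _ → v) classify (λ _ _ e → e)
  (≲-⊎ (exit-≲ t n d)
    (≲-map {P = λ v → Region t n v × ¬ Region t n (v ⊕ total sq ds)} {Q = λ v → Region t n (v ⊕ step sq d) × ¬ Region t n (v ⊕ step sq d ⊕ total sq ds)}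
       (λ {v} _ → v ⊕ step sq d) id (λ _ _ → ⊕-cancelʳ (step sq d)) (escape-≲ t n ds)))
  where
  classify : ∀ {v} → Region t n v × ¬ Region t n (v ⊕ total sq (d ∷ ds)) →
    Region t n v × ¬ Region t n (v ⊕ step sq d) ⊎ Region t n (v ⊕ step sq d) × ¬ Region t n (v ⊕ step sq d ⊕ total sq ds)
  classify {v} (r , ¬r) with region? t n (v ⊕ step sq d)
  ... | yes s = inj₂ (s , λ q → ¬r (subst (Region t n) (⊕-assoc v _ _) q))
  ... | no ¬s = inj₁ (r , ¬s)

column-connected : ∀ b → ∃[ ds ] total sq ds ≡ (+ 0 , b)
column-connected (+ 0) = [] , refl
column-connected (+ suc b) with column-connected (+ b)
... | ds , eq = # 2 ∷ ds , cong (step sq (# 2) ⊕_) eq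
column-connected -[1+ 0 ] = # 3 ∷ [] , refl
column-connected -[1+ suc b ] with column-connected -[1+ b ]
... | ds , eq = # 3 ∷ ds , cong (step sq (# 3) ⊕_) eq

sq-connected : ∀ a b → ∃[ ds ] total sq ds ≡ (a , b)
sq-connected (+ 0) b = column-connected b
sq-connected (+ suc a) b with sq-connected (+ a) b
... | ds , eq = # 0 ∷ ds , trans (cong (step sq (# 0) ⊕_) eq) (cong (+ suc a ,_) (ℤₚ.+-identityˡ b))
sq-connected -[1+ 0 ] b with column-connected b
... | ds , eq = # 1 ∷ ds , trans (cong (step sq (# 1) ⊕_) eq) (cong (-[1+ 0 ] ,_) (ℤₚ.+-identityˡ b))
sq-connected -[1+ suc a ] b with sq-connected -[1+ a ] b
... | ds , eq = # 1 ∷ ds , trans (cong (step sq (# 1) ⊕_) eq) (cong (-[1+ suc a ] ,_) (ℤₚ.+-identityˡ b))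

Near : ∀ t {J} → (Fin J → V) → ℕ → V → Set
Near t o n v = Region t n v × ∃[ j ] ¬ Region t n (v ⊕ o j)

-- `A` is the total length of unit-step paths to the offsets, hence independent of `n`.
near-≲ : ∀ t {J} (o : Fin J → V) → ∃[ A ] ∀ n → Near t o n ≲ A * width n
near-≲ t {zero} o = 0 , λ n → record { code = λ { (_ , () , _) } ; code-inj = λ { (_ , () , _) } }
near-≲ t {suc J} o with sq-connected (proj₁ (o zero)) (proj₂ (o zero)) | near-≲ t (o ∘ suc)
... | ds , eq | A , bound = length ds + A , λ n → subst (Near t o n ≲_) (sym (ℕₚ.*-distribʳ-+ (width n) (length ds) A))
  (≲-map (λ {v} _ → v) (split n) (λ _ _ e → e) (≲-⊎ (escape-≲ t n ds) (bound n)))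
  where
  split : ∀ n {v} → Near t o n v → Region t n v × ¬ Region t n (v ⊕ total sq ds) ⊎ Near t (o ∘ suc) n v
  split n {v} (r , zero , ¬r) = inj₁ (r , subst (λ w → ¬ Region t n (v ⊕ w)) (sym eq) ¬r)
  split n (r , suc j , ¬r) = inj₂ (r , j , ¬r)

-- Bounds for maximal packings

Edge : ∀ t → ℕ → V × V → Set
Edge t n (u , v) = T (adjR t n u v)

edge-inR : ∀ t n {e} → Edge t n e → T (inR t n (proj₁ e)) × T (inR t n (proj₂ e)) × T (adj t (proj₁ e) (proj₂ e))
edge-inR t n {u , v} e with T-∧⁻ {inR t n u} e
... | p , q = p , T-∧⁻ {inR t n v} q

concatMap-map : ∀ {A B C : Set} (f : A → B → C) xs ys → concatMap (λ x → map (f x) ys) xs ≡ cartesianProductWith f xs ys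
concatMap-map f [] ys = refl
concatMap-map f (x ∷ xs) ys = cong (map (f x) ys ++_) (concatMap-map f xs ys)

box-point : ℕ → ℕ → ℕ → V
box-point n i j = + i ℤ.- + (2 * n) , + j

box≡ : ∀ n → box n ≡ cartesianProductWith (box-point n) (upTo (suc (4 * n))) (upTo (suc (2 * n)))
box≡ n = concatMap-map (box-point n) (upTo (suc (4 * n))) (upTo (suc (2 * n)))

vertices-unique : ∀ t n → Unique (vertices t n)
vertices-unique t n = Uniqueₚ.filter⁺ (T? ∘ inR t n) (subst Unique (sym (box≡ n))
  (Uniqueₚ.cartesianProductWith⁺ (box-point n) injective (Uniqueₚ.upTo⁺ (suc (4 * n))) (Uniqueₚ.upTo⁺ (suc (2 * n)))))
  where
  injective : ∀ {i j k l} → box-point n i k ≡ box-point n j l → i ≡ j × k ≡ l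
  injective {i} {j} eq = ℤₚ.+-injective (trans (sym (⊖+ (+ i))) (trans (cong (ℤ._+ + (2 * n)) (cong proj₁ eq)) (⊖+ (+ j)))) ,
                 ℤₚ.+-injective (cong proj₂ eq)
    where
    ⊖+ : ∀ x → x ℤ.- + (2 * n) ℤ.+ + (2 * n) ≡ x
    ⊖+ x = cong proj₁ (⊖-⊕ (x , x) (+ (2 * n) , x))

inR⇒vertex : ∀ t n v → T (inR t n v) → v ∈ vertices t n
inR⇒vertex t n v@(a , b) p with region-bounded t n (inR⇒region t n v p)
... | (lo , hi) , (_ , b≤2n) , 0≤b = ∈-filter⁺ (T? ∘ inR t n) (subst (v ∈_) (sym (box≡ n))
      (subst (_∈ _) (cong₂ _,_ a≡ (ℤₚ.0≤i⇒+∣i∣≡i 0≤b))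
        (∈-cartesianProductWith⁺ (box-point n) (∈-upTo⁺ (s≤s i≤)) (∈-upTo⁺ (s≤s (ℤₚ.drop‿+≤+ (subst (ℤ._≤ _) (sym (ℤₚ.0≤i⇒+∣i∣≡i 0≤b)) b≤2n))))))) p
  where
  i = ℤ.∣ a ℤ.+ + (2 * n) ∣
  a≡ : + i ℤ.- + (2 * n) ≡ a
  a≡ = trans (cong (ℤ._- + (2 * n)) (ℤₚ.0≤i⇒+∣i∣≡i lo)) (cong proj₁ (⊕-⊖ (a , a) (+ (2 * n) , a)))
  i≤ : i ≤ 4 * n
  i≤ = subst (i ≤_) (double n) (ℤₚ.drop‿+≤+ (subst (ℤ._≤ _) (sym (ℤₚ.0≤i⇒+∣i∣≡i lo)) (ℤₚ.+-monoˡ-≤ (+ (2 * n)) hi)))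
    where
    double : ∀ n → 2 * n + 2 * n ≡ 4 * n
    double = ℕS.solve-∀

edgeList : ∀ t n → List (V × V)
edgeList t n = filterᵇ (uncurry (adjR t n)) (cartesianProduct (vertices t n) (vertices t n))

orderedEdges≡ : ∀ t n → orderedEdges t n ≡ length (edgeList t n)
orderedEdges≡ t n = sum-indicators (adjR t n) (vertices t n) (vertices t n)

-- Whatever injects into the darts is bounded by `orderedEdges`, which the upper bound and the
-- quadratic growth use. The converse `orderedEdges-≤` serves the lower bound.
edge-≲ : ∀ t n → Edge t n ≲ orderedEdges t n
edge-≲ t n = subst (Edge t n ≲_) (sym (orderedEdges≡ t n))
  (≲-map (λ {e} _ → e) (λ {e} p → let p₁ , p₂ , _ = edge-inR t n p in
     ∈-filter⁺ (T? ∘ uncurry (adjR t n)) (∈-cartesianProduct⁺ (inR⇒vertex t n _ p₁) (inR⇒vertex t n _ p₂)) p)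
   (λ _ _ e → e) (≲-∈ (edgeList t n)))

orderedEdges-≤ : ∀ t n {N} → Edge t n ≲ N → orderedEdges t n ≤ N
orderedEdges-≤ t n c = subst (_≤ _) (sym (orderedEdges≡ t n))
  (≲-length (Uniqueₚ.filter⁺ (T? ∘ uncurry (adjR t n)) (Uniqueₚ.cartesianProduct⁺ (vertices-unique t n) (vertices-unique t n)))
    (λ e∈ → proj₂ (∈-filter⁻ (T? ∘ uncurry (adjR t n)) {xs = cartesianProduct (vertices t n) (vertices t n)} e∈)) c)

inRegion? : ∀ t n x → Dec (InRegion t n x)
inRegion? t n x = All.all? (λ v → T? (inR t n v)) (corners t x)

-- Only the extent of the region can exclude a corner, not the deleted hexagon centres.
missing-corner : ∀ t n b d → T (lat t (proj₁ (edge t (b , d)))) → T (lat t (proj₂ (edge t (b , d)))) →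
  ¬ InRegion t n (b , d) → ∃[ e ] ¬ Region t n (b ⊕ off t e)
missing-corner t n b d l₁ l₂ out
  with find (Anyₚ.map⁻ (Allₚ.¬All⇒Any¬ (λ v → T? (inR t n v)) (corners t (b , d)) out))
... | e , e∈ , ¬in = e , λ r → ¬in (region⇒inR t n (b ⊕ off t e) r
        (lat-face t b d e (All.lookup (ring-rep t d) e∈) l₁ l₂))

-- Near-boundary flags: the offsets o lead from the start of a dart to the corners of some nearby face.
NearFlag : ∀ t {J} → (Fin J → V) → ℕ → Dir t × V → Set
NearFlag t o n (d , v) = ⊤ × Near t o n v

nearFlag-≲ : ∀ t {J} (o : Fin J → V) → ∃[ A ] ∀ n → NearFlag t o n ≲ A * width n
nearFlag-≲ t o with near-≲ t o
... | A , bound = length (steps t) * A , λ n → subst (NearFlag t o n ≲_) (sym (ℕₚ.*-assoc (length (steps t)) A (width n)))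
  (≲-× (≲-Fin (λ _ → ⊤)) (bound n))

-- `Near` expects offsets indexed by a single `Fin`, so pairs of directions are packed into one.
pairwise : ∀ {A : Set} {m} → (Fin m → Fin m → A) → Fin (m * m) → A
pairwise {m = m} f = uncurry f ∘ Fin.remQuot m

pairwise-combine : ∀ {A : Set} {m} (f : Fin m → Fin m → A) i j → pairwise f (Fin.combine i j) ≡ f i j
pairwise-combine f i j = cong (uncurry f) (Finₚ.remQuot-combine i j)

sameFace-colour : ∀ t {x y} → SameFace t x y → colour t x ≡ colour t y
sameFace-colour t {b , _} (refl , same) = colour-face t b same

-- Lower bound: how many faces a packed face can dominate

Adjacent : ∀ t → Flag t → Flag t → Set
Adjacent t x (b , d) = SameFace t x (b , d) ⊎ ∃[ e ] rep t e ≡ rep t d × SameFace t x (opp t (b , e))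

adjacent-colour : ∀ t {x x′} y → Adjacent t x y → Adjacent t x′ y → colour t x ≡ colour t x′ → SameFace t x x′
adjacent-colour t y (inj₁ s) (inj₁ s′) eq = SameFace-trans t s (SameFace-sym t s′)
adjacent-colour t (b , d) (inj₁ s) (inj₂ (e , same , s′)) eq = contradiction
  (trans (sym (sameFace-colour t s)) (trans eq (sameFace-colour t s′))) (neighbour≢centre t b (sym same))
adjacent-colour t (b , d) (inj₂ (e , same , s)) (inj₁ s′) eq = contradiction
  (trans (sym (sameFace-colour t s′)) (trans (sym eq) (sameFace-colour t s))) (neighbour≢centre t b (sym same))
adjacent-colour t (b , d) (inj₂ (e , same , s)) (inj₂ (e′ , same′ , s′)) eq
  with neighbour-unique t {b} {e} {e′} (trans same (sym same′)) (trans (sym (sameFace-colour t s)) (trans eq (sameFace-colour t s′)))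
... | refl = SameFace-trans t s (SameFace-sym t s′)

module _ {t : Tiling} {n : ℕ} where
  shared-edge⇒adjacent : ∀ {b d} ins {f g} (C : Copy t n) {y} → SameEdges t (cycEdges (verts C)) y →
    f ∈ cycEdges (verts (faceCopy (b , d) ins)) → g ∈ cycEdges (verts C) → SameEdge f g → Adjacent t (b , d) y
  shared-edge⇒adjacent {b} {d} ins C {c , d′} (covered , _) f∈ g∈ same
    with faceCopy-edge⁻ {t} {n} {b} {d} ins f∈ | find (All.lookup covered g∈)
  ... | e , rep≡ , refl | e′ , e′∈ , same′
    with sameEdge⇒flag t {c , e′} {b , e} (SameEdge-sym (SameEdge-trans same same′))
  ... | inj₁ refl = inj₁ (refl , trans (sym rep≡) (All.lookup (ring-rep t d′) e′∈))
  ... | inj₂ refl = inj₂ (e′ , All.lookup (ring-rep t d′) e′∈ , refl , sym rep≡)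

  -- Every side of the face is an edge of the copy, so its corners are vertices of the copy.
  copy-inRegion : ∀ (C : Copy t n) {b d} → SameEdges t (cycEdges (verts C)) (b , d) → InRegion t n (b , d)
  copy-inRegion C {b} {d} (_ , covers) = Allₚ.map⁺ (All.map corner covers)
    where
    endpoints : ∀ {e f} → SameEdge e f → Edge t n f → T (inR t n (proj₁ e))
    endpoints (inj₁ (refl , refl)) p = proj₁ (edge-inR t n p)
    endpoints (inj₂ (refl , refl)) p = proj₁ (proj₂ (edge-inR t n p))
    corner : ∀ {e} → Any (SameEdge (edge t (b , e))) (cycEdges (verts C)) → T (inR t n (b ⊕ off t e))
    corner any = let f , f∈ , same = find any in endpoints same (All.lookup (adjacent C) f∈)

faces-dominated : ∀ t → ∃[ A ] ∀ n (P : List (Copy t n)) → IsMaximalPacking P →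
  orderedEdges t n ≤ length P * (suc (sides t) * sides t) + A * width n
faces-dominated t = proj₁ near , λ n P max → orderedEdges-≤ t n (bound n P max)
  where
  o : Fin (length (steps t) * length (steps t)) → V
  o = pairwise (λ d e → off t e ⊖ off t d)
  near = nearFlag-≲ t o
  module _ (n : ℕ) (P : List (Copy t n)) (max : IsMaximalPacking P) where
    Good : V × V → Set
    Good e = ∃[ x ] edge t x ≡ e × ∃[ i ] Adjacent t x (proj₁ (copy-face (lookup P i)))
    Bad : V × V → Set
    Bad (u , v) = ∃[ d ] v ≡ u ⊕ step t d × Near t o n u

    good-≲ : Good ≲ length P * (suc (sides t) * sides t)
    good-≲ .code ((b , d) , _ , i , _) = Fin.combine i (Fin.combine (colour t (b , d)) (pos t d))
    good-≲ .code-inj ((b , d) , refl , i , a) ((b′ , d′) , refl , i′ , a′) eq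
      with Finₚ.combine-injective i _ i′ _ eq
    ... | refl , eq′ with Finₚ.combine-injective (colour t (b , d)) (pos t d) (colour t (b′ , d′)) (pos t d′) eq′
    ... | colour≡ , pos≡ with adjacent-colour t _ a a′ colour≡
    ... | refl , rep≡ = cong (λ e → edge t (b , e)) (repPos-injective t d d′ rep≡ pos≡)

    bad-≲ : Bad ≲ proj₁ near * width n
    bad-≲ = ≲-map (λ { {u , v} (d , _) → d , u }) (λ { (_ , _ , r) → tt , r })
      (λ { (_ , refl , _) (_ , refl , _) refl → refl }) (proj₂ near n)

    classify : ∀ {e} → Edge t n e → Good e ⊎ Bad e
    classify {u , v} p with edge-inR t n p
    ... | p₁ , p₂ , p₃ with adj-sound t u v p₃
    ... | d , refl with inRegion? t n (flag t u d)
    ... | no out = inj₂ (d , refl , inR⇒region t n u p₁ , Fin.combine d (proj₁ missing) ,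
          λ r → proj₂ missing (subst (Region t n) (trans (cong (u ⊕_) (pairwise-combine (λ d e → off t e ⊖ off t d) d _)) (rearrange u (off t d) _)) r))
      where
      missing = missing-corner t n (u ⊖ off t d) d
        (subst (λ e → T (lat t (proj₁ e))) (sym (edge-flag t u d)) (lat-inR t n u p₁))
        (subst (λ e → T (lat t (proj₂ e))) (sym (edge-flag t u d)) (lat-inR t n _ p₂)) out
      rearrange : ∀ u v w → u ⊕ (w ⊖ v) ≡ u ⊖ v ⊕ w
      rearrange (a , b) (c , d) (e , f) = cong₂ _,_ (lemma a c e) (lemma b d f)
        where
        lemma : ∀ x y z → x ℤ.+ (z ℤ.- y) ≡ x ℤ.- y ℤ.+ z
        lemma = solve-∀
    -- A face inside the region is itself a copy, so maximality yields a packed copy sharing an edge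
    -- with it.
    ... | yes ins with meets-member (faceCopy (flag t u d) ins) P (proj₂ max (faceCopy (flag t u d) ins))
    ... | i , _ , _ , e∈ , f∈ , same = inj₁ (flag t u d , edge-flag t u d , i ,
          shared-edge⇒adjacent ins (lookup P i) (proj₂ (copy-face (lookup P i))) e∈ f∈ same)

    bound : Edge t n ≲ length P * (suc (sides t) * sides t) + proj₁ near * width n
    bound = ≲-map (λ {e} _ → e) classify (λ _ _ e → e) (≲-⊎ good-≲ bad-≲)

-- Upper bound: extending a colour class to a maximal packing

length-cartesianProduct : ∀ {A B : Set} (xs : List A) (ys : List B) → length (cartesianProduct xs ys) ≡ length xs * length ys
length-cartesianProduct [] ys = refl
length-cartesianProduct (x ∷ xs) ys = trans (Listₚ.length-++ (map (x ,_) ys))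
  (cong₂ _+_ (Listₚ.length-map _ ys) (length-cartesianProduct xs ys))

-- From the start of side `d` of a face to corner `e` of the face across that side.
neighbourOffset : ∀ t → Fin (length (steps t) * length (steps t)) → V
neighbourOffset t = pairwise (λ d e → δ t d ⊕ off t e ⊖ off t d)

module _ (t : Tiling) (n : ℕ) where
  flag-edge : ∀ b d → flag t (b ⊕ off t d) d ≡ (b , d)
  flag-edge b d = cong (_, d) (⊕-⊖ b (off t d))

  -- The condition on `rep` selects one flag per face, so that `faces` lists no face twice.
  IsFace : Flag t → Set
  IsFace (b , d) = rep t d ≡ d × InRegion t n (b , d)

  isFace? : ∀ x → Dec (IsFace x)
  isFace? (b , d) = (rep t d Finₚ.≟ d) ×-dec inRegion? t n (b , d)

  allFlags faces : List (Flag t)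
  allFlags = cartesianProductWith (flag t) (vertices t n) (allFin _)
  faces = filter isFace? allFlags

  faces-unique : Unique faces
  faces-unique = Uniqueₚ.filter⁺ isFace? (Uniqueₚ.cartesianProductWith⁺ (flag t) injective (vertices-unique t n) (Uniqueₚ.allFin⁺ _))
    where
    injective : ∀ {u v d e} → flag t u d ≡ flag t v e → u ≡ v × d ≡ e
    injective {u} {v} {d} {e} eq = trans (sym (cong proj₁ (edge-flag t u d))) (trans (cong (proj₁ ∘ edge t) eq) (cong proj₁ (edge-flag t v e))) , cong proj₂ eq

  face∈faces : ∀ b d → InRegion t n (b , d) → (b , rep t d) ∈ faces
  face∈faces b d ins = ∈-filter⁺ isFace?
    (subst (_∈ allFlags) (flag-edge b (rep t d))
      (∈-cartesianProductWith⁺ (flag t) (inR⇒vertex t n _ (corner (rep t d) (rep-rep t d))) (∈-allFin (rep t d))))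
    (rep-rep t d , Allₚ.map⁺ (All.tabulate λ {e} e∈ → corner e (trans (All.lookup (ring-rep t (rep t d)) e∈) (rep-rep t d))))
    where
    corner : ∀ e → rep t e ≡ rep t d → T (inR t n (b ⊕ off t e))
    corner e same = All.lookup ins (∈-map⁺ _ (ring-complete t d e same))

  -- Each face is on the left of `k` darts, and a dart determines its left face; counted by darts,
  -- neighbouring faces share nothing.
  faces≤edges : length faces * sides t ≤ orderedEdges t n
  faces≤edges = subst (_≤ orderedEdges t n)
    (trans (length-cartesianProduct faces (allFin (sides t))) (cong (length faces *_) (Listₚ.length-tabulate {n = sides t} id)))
    (≲-length (Uniqueₚ.cartesianProduct⁺ faces-unique (Uniqueₚ.allFin⁺ (sides t)))
      (λ x∈ → proj₂ (∈-filter⁻ isFace? {xs = allFlags} (proj₁ (∈-cartesianProduct⁻ faces (allFin (sides t)) x∈))))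
      (≲-map {Q = λ xi → IsFace (proj₁ xi)} (λ {xi} _ → side xi)
        (λ { {(b , d) , i} (_ , ins) → InRegion-edge b d _ (proj₁ (proj₂ (pos-surjective t d i))) ins })
        (λ {xi} {yj} → side-injective xi yj) (edge-≲ t n)))
    where
    side : Flag t × Fin (sides t) → V × V
    side ((b , d) , i) = edge t (b , proj₁ (pos-surjective t d i))
    side-injective : ∀ xi yj → IsFace (proj₁ xi) → IsFace (proj₁ yj) → side xi ≡ side yj → xi ≡ yj
    side-injective ((b , d) , i) ((c , e) , j) (rd , _) (re , _) eq
      with pos-surjective t d i | pos-surjective t e j
    ... | f , rf , pf | g , rg , pg with edge-injective t {b , f} {c , g} eq
    ... | refl = cong₂ (λ d i → (b , d) , i) (trans (sym rd) (trans (trans (sym rf) rg) re)) (trans (sym pf) pg)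

  module _ (j : Fin (suc (sides t))) where
    colourClass : List (Flag t)
    colourClass = filter (λ x → colour t x Finₚ.≟ j) faces

    Coloured : Flag t → Set
    Coloured x = IsFace x × colour t x ≡ j

    faceCopies : ∀ xs → All Coloured xs → List (Copy t n)
    faceCopies [] [] = []
    faceCopies (x ∷ xs) (((_ , ins) , _) ∷ cs) = faceCopy x ins ∷ faceCopies xs cs

    faceCopies-length : ∀ xs cs → length (faceCopies xs cs) ≡ length xs
    faceCopies-length [] [] = refl
    faceCopies-length (x ∷ xs) (_ ∷ cs) = cong suc (faceCopies-length xs cs)

    faceCopies-∈ : ∀ {xs} cs {x} → x ∈ xs → ∃[ ins ] faceCopy x ins ∈ faceCopies xs cs
    faceCopies-∈ (((_ , ins) , _) ∷ cs) (here refl) = ins , here refl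
    faceCopies-∈ (_ ∷ cs) (there x∈) = let ins , c∈ = faceCopies-∈ cs x∈ in ins , there c∈

    same-colour-disjoint : ∀ {x y} (p : Coloured x) (q : Coloured y) → x ≢ y →
      EdgeDisjoint (faceCopy {t} {n} x (proj₂ (proj₁ p))) (faceCopy y (proj₂ (proj₁ q)))
    same-colour-disjoint {b , d} {c , e} ((rd , ins) , col) ((re , ins′) , col′) x≢y f∈ g∈ same
      with faceCopy-edge⁻ {t} {n} {b} {d} ins f∈ | faceCopy-edge⁻ {t} {n} {c} {e} ins′ g∈
    ... | f , rf , refl | g , rg , refl with sameEdge⇒flag t {c , g} {b , f} (SameEdge-sym same)
    ... | inj₁ refl = x≢y (cong (b ,_) (trans (sym rd) (trans (trans (sym rf) rg) re)))
    ... | inj₂ eq = neighbour≢centre t c {e} {g} (sym rg) (trans col′ (trans (sym col)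
          (trans (colour-face t b (sym rf)) (cong (colour t) eq))))

    faceCopies-packing : ∀ {xs} cs → Unique xs → IsPacking (faceCopies xs cs)
    faceCopies-packing [] [] = []
    faceCopies-packing {x ∷ _} (c ∷ cs) (x≢ ∷ u) = tail cs x≢ ∷ faceCopies-packing cs u
      where
      tail : ∀ {ys} (ds : All Coloured ys) → All (x ≢_) ys → All (EdgeDisjoint (faceCopy x (proj₂ (proj₁ c)))) (faceCopies ys ds)
      tail [] [] = []
      tail (d ∷ ds) (x≢y ∷ x≢) = same-colour-disjoint c d x≢y ∷ tail ds x≢

    colourClass-coloured : All Coloured colourClass
    colourClass-coloured = All.tabulate λ x∈ →
      let x∈faces , col = ∈-filter⁻ (λ x → colour t x Finₚ.≟ j) {xs = faces} x∈
      in proj₂ (∈-filter⁻ isFace? {xs = allFlags} x∈faces) , col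

    classPacking : List (Copy t n)
    classPacking = faceCopies colourClass colourClass-coloured

    -- A copy avoiding the j-coloured faces must be dominated by a j-coloured face that sticks out of the region.
    classPacking-blocks : ∀ (C : Copy t n) → All (EdgeDisjoint C) classPacking → ∀ b d →
      (∃[ e ] rep t e ≡ rep t d × Any (SameEdge (edge t (b , e))) (cycEdges (verts C))) →
      colour t (b , d) ≡ j → ¬ InRegion t n (b , d)
    classPacking-blocks C disj b d (e , same , any) col ins
      with find any | faceCopies-∈ colourClass-coloured (∈-filter⁺ (λ x → colour t x Finₚ.≟ j) (face∈faces b d ins) (trans (colour-rep t b d) col))
    ... | f , f∈ , same′ | ins′ , copy∈ = All.lookup disj copy∈ f∈
          (faceCopy-edge⁺ {t} {n} {b} {rep t d} ins′ e (trans same (sym (rep-rep t d)))) (SameEdge-sym same′)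

    -- The witness records a side along which `C` runs rather than the outlying face beyond it:
    -- disjoint copies then have distinct witnesses, so near-boundary flags bound their number.
    Exposed : Copy t n → Set
    Exposed C = ∃[ b ] ∃[ e ] Any (SameEdge (edge t (b , e))) (cycEdges (verts C)) × Near t (neighbourOffset t) n (b ⊕ off t e)

    exposed : ∀ C → All (EdgeDisjoint C) classPacking → Exposed C
    exposed C disj = [ isolated , side ]′ (colour-dominates t b d j)
      where
      b = proj₁ (proj₁ (copy-face C))
      d = proj₂ (proj₁ (copy-face C))
      both = proj₂ (copy-face C)
      ins = copy-inRegion C {b} {d} both
      hit : ∀ e → rep t e ≡ rep t d → Any (SameEdge (edge t (b , e))) (cycEdges (verts C))
      hit e same = All.lookup (proj₂ both) (ring-complete t d e same)
      isolated : colour t (b , d) ≡ j → Exposed C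
      -- The face of `C` lies in the region, so with colour `j` it would be packed and `C` would
      -- share its edges.
      isolated col = contradiction ins (classPacking-blocks C disj b d (d , refl , hit d refl) col)
      side : ∃[ e ] rep t e ≡ rep t d × colour t (opp t (b , e)) ≡ j → Exposed C
      side (e , same , col) = b , e , hit e same , inR⇒region t n _ (proj₁ ends) , Fin.combine e (proj₁ missing) ,
          λ r → proj₂ missing (subst (Region t n) (trans (cong (b ⊕ off t e ⊕_)
                  (pairwise-combine (λ d e → δ t d ⊕ off t e ⊖ off t d) e (proj₁ missing)))
                  (rearrange b (off t e) (δ t e) (off t (proj₁ missing)))) r)
        where
        ends = edge-inR t n (InRegion-edge b d e same ins)
        out = classPacking-blocks C disj (b ⊕ δ t e) (op t e)
          (op t e , refl , Any.map (SameEdge-trans (sameEdge-opp t (b , e))) (hit e same)) col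
        missing = missing-corner t n (b ⊕ δ t e) (op t e)
          (subst (λ f → T (lat t (proj₁ f))) (sym (edge-opp t (b , e))) (lat-inR t n _ (proj₁ (proj₂ ends))))
          (subst (λ f → T (lat t (proj₂ f))) (sym (edge-opp t (b , e))) (lat-inR t n _ (proj₁ ends))) out
        rearrange : ∀ b u v w → b ⊕ u ⊕ (v ⊕ w ⊖ u) ≡ b ⊕ v ⊕ w
        rearrange (b , b′) (u , u′) (v , v′) (w , w′) = cong₂ _,_ (lemma b u v w) (lemma b′ u′ v′ w′)
          where
          lemma : ∀ b u v w → b ℤ.+ u ℤ.+ (v ℤ.+ w ℤ.- u) ≡ b ℤ.+ v ℤ.+ w
          lemma = solve-∀

    colourClass-unique : Unique colourClass
    colourClass-unique = Uniqueₚ.filter⁺ (λ x → colour t x Finₚ.≟ j) faces-unique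

    classPacking-extends : ∃[ Q ] AllPairs EdgeDisjoint Q × All (λ C → All (EdgeDisjoint C) classPacking) Q ×
      IsMaximalPacking (Q ++ classPacking)
    classPacking-extends = extend {t} {n} (vertices t n) (inR⇒vertex t n) {classPacking}
      (faceCopies-packing colourClass-coloured colourClass-unique)

    exposed-flag : ∀ {C} → Exposed C → Dir t × V
    exposed-flag (b , e , _) = e , b ⊕ off t e

    exposed-near : ∀ {C} (x : Exposed C) → NearFlag t (neighbourOffset t) n (exposed-flag {C} x)
    exposed-near (_ , _ , _ , near) = tt , near

    exposed-meet : ∀ {C D} (x : Exposed C) (y : Exposed D) → exposed-flag {C} x ≡ exposed-flag {D} y → ¬ EdgeDisjoint C D
    exposed-meet {C} {D} (b , e , hit , _) (c , f , hit′ , _) eq disj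
      with find hit | find hit′
    ... | _ , x∈ , s | _ , y∈ , s′ = disj x∈ y∈ (SameEdge-trans (SameEdge-sym s)
          (subst (λ g → SameEdge g _) (sym (cong (edge t) same)) s′))
      where
      same : (b , e) ≡ (c , f)
      same = trans (sym (flag-edge b e)) (trans (cong (λ dv → flag t (proj₂ dv) (proj₁ dv)) eq) (flag-edge c f))

    new-copies : ∀ {N} {Q : List (Copy t n)} → NearFlag t (neighbourOffset t) n ≲ N → AllPairs EdgeDisjoint Q →
      All (λ C → All (EdgeDisjoint C) classPacking) Q → length Q ≤ N
    new-copies {N} {Q} near pairs new = AllPairs-length pairs
      (λ {C} C∈ → code near (exposed-near {C} (blocked C∈)))
      (λ {C} {D} p q eq → exposed-meet {C} {D} (blocked p) (blocked q) (code-inj near _ _ eq))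
      where
      blocked : ∀ {C} → C ∈ Q → Exposed C
      blocked {C} C∈ = exposed C (All.lookup new C∈)

    classPacking-length : suc (sides t) * length colourClass ≤ length faces →
      length classPacking * (suc (sides t) * sides t) ≤ orderedEdges t n
    classPacking-length share = begin
      length classPacking * (suc (sides t) * sides t)
        ≡⟨ cong (_* (suc (sides t) * sides t)) (faceCopies-length colourClass colourClass-coloured) ⟩
      length colourClass * (suc (sides t) * sides t) ≡⟨ rearrange (length colourClass) (suc (sides t)) (sides t) ⟩
      suc (sides t) * length colourClass * sides t ≤⟨ ℕₚ.*-monoˡ-≤ (sides t) share ⟩
      length faces * sides t ≤⟨ faces≤edges ⟩
      orderedEdges t n ∎
      where
      open ℕₚ.≤-Reasoning
      rearrange : ∀ x y z → x * (y * z) ≡ y * x * z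
      rearrange = ℕS.solve-∀

    small-packing : ∀ {N} → NearFlag t (neighbourOffset t) n ≲ N → suc (sides t) * length colourClass ≤ length faces →
      ∃[ P ] IsMaximalPacking {t} {n} P ×
        length P * (suc (sides t) * sides t) ≤ orderedEdges t n + N * (suc (sides t) * sides t)
    small-packing {N} near share = Q ++ classPacking , proj₂ (proj₂ (proj₂ classPacking-extends)) , (begin
      length (Q ++ classPacking) * k′ ≡⟨ cong (_* k′) (trans (Listₚ.length-++ Q) (ℕₚ.+-comm (length Q) (length classPacking))) ⟩
      (length classPacking + length Q) * k′ ≡⟨ ℕₚ.*-distribʳ-+ k′ (length classPacking) (length Q) ⟩
      length classPacking * k′ + length Q * k′ ≤⟨ ℕₚ.+-mono-≤ (classPacking-length share) (ℕₚ.*-monoˡ-≤ k′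
        (new-copies near (proj₁ (proj₂ classPacking-extends)) (proj₁ (proj₂ (proj₂ classPacking-extends))))) ⟩
      orderedEdges t n + N * k′ ∎)
      where
      open ℕₚ.≤-Reasoning
      Q = proj₁ classPacking-extends
      k′ = suc (sides t) * sides t

few-faces : ∀ t → ∃[ A ] ∀ n → ∃[ P ] IsMaximalPacking {t} {n} P ×
  length P * (suc (sides t) * sides t) ≤ orderedEdges t n + A * width n
few-faces t = A * k′ , λ n →
  let j , share = fair-share (colour t) (faces-unique t n)
      P , max , few = small-packing t n j (proj₂ (nearFlag-≲ t (neighbourOffset t)) n) share
  in P , max , subst (λ N → length P * k′ ≤ orderedEdges t n + N) (rearrange A (width n) k′) few
  where
  A = proj₁ (nearFlag-≲ t (neighbourOffset t))
  k′ = suc (sides t) * sides t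
  rearrange : ∀ x y z → x * y * z ≡ x * z * y
  rearrange = ℕS.solve-∀

-- The limit

east : ∀ t → Dir t
east tri = # 0
east sq  = # 0
east hex = # 0

-- Spacing 3 keeps `a - b` congruent to `ε` modulo 3, so with `ε` at most 1 no deleted hexagon
-- centre occurs.
gridPoint : ℕ → ℕ → ℕ → V
gridPoint ε x y = + (3 * x + ε) , + (3 * y)

gridPoint-east : ∀ t x y → gridPoint 1 x y ≡ gridPoint 0 x y ⊕ step t (east t)
gridPoint-east t x y = trans (cong₂ _,_ (cong (λ z → + (z + 1)) (sym (ℕₚ.+-identityʳ (3 * x)))) (sym (ℤₚ.+-identityʳ _))) (go t)
  where
  go : ∀ t → gridPoint 0 x y ⊕ (+ 1 , + 0) ≡ gridPoint 0 x y ⊕ step t (east t)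
  go tri = refl
  go sq  = refl
  go hex = refl

-- The 9 is 6 + 3, from bounding `2a + b` in the slanted coordinates.
gridPoint-region : ∀ t {m n ε x y} → 9 * m ≤ n → ε ≤ 1 → x < m → y < m → Region t n (gridPoint ε x y)
gridPoint-region t {m} {n} {ε} {x} {y} 9m≤n ε≤1 x<m y<m = go t
  where
  open ℕₚ.≤-Reasoning
  3*<n : ∀ {z} → z < m → 3 * z + 3 ≤ n
  3*<n {z} z<m = begin
    3 * z + 3 ≡⟨ rearrange z ⟩
    3 * suc z ≤⟨ ℕₚ.*-mono-≤ (ℕₚ.m≤m+n 3 6) z<m ⟩
    9 * m ≤⟨ 9m≤n ⟩
    n ∎
    where
    rearrange : ∀ z → 3 * z + 3 ≡ 3 * suc z
    rearrange = ℕS.solve-∀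
  x-bound : 3 * x + ε + 1 ≤ n
  x-bound = begin
    3 * x + ε + 1 ≤⟨ ℕₚ.+-monoˡ-≤ 1 (ℕₚ.+-monoʳ-≤ (3 * x) ε≤1) ⟩
    3 * x + 1 + 1 ≡⟨ ℕₚ.+-assoc (3 * x) 1 1 ⟩
    3 * x + 2 ≤⟨ ℕₚ.+-monoʳ-≤ (3 * x) (ℕₚ.n≤1+n 2) ⟩
    3 * x + 3 ≤⟨ 3*<n x<m ⟩
    n ∎
  y-bound : 3 * y + 1 ≤ n
  y-bound = ℕₚ.≤-trans (ℕₚ.+-monoʳ-≤ (3 * y) (s≤s z≤n)) (3*<n y<m)
  height : 3 * (3 * y) * (3 * y) + 1 ≤ 4 * n * n
  height = begin
    3 * (3 * y) * (3 * y) + 1 ≤⟨ ℕₚ.+-mono-≤ (ℕₚ.*-mono-≤ (ℕₚ.*-monoʳ-≤ 3 y≤n) y≤n) (ℕₚ.*-mono-≤ 1≤n 1≤n) ⟩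
    3 * n * n + n * n ≡⟨ collect n ⟩
    4 * n * n ∎
    where
    y≤n = ℕₚ.≤-trans (ℕₚ.m≤m+n (3 * y) 1) y-bound
    1≤n = ℕₚ.≤-trans (ℕₚ.m≤n+m 1 (3 * y)) y-bound
    collect : ∀ n → 3 * n * n + n * n ≡ 4 * n * n
    collect = ℕS.solve-∀
  span : 2 * (3 * x + ε) + 3 * y + 1 ≤ 2 * n
  span = begin
    2 * (3 * x + ε) + 3 * y + 1 ≤⟨ ℕₚ.+-monoˡ-≤ 1 (ℕₚ.+-monoˡ-≤ (3 * y) (ℕₚ.*-monoʳ-≤ 2 (ℕₚ.+-monoʳ-≤ (3 * x) ε≤1))) ⟩
    2 * (3 * x + 1) + 3 * y + 1 ≤⟨ ℕₚ.m≤m+n _ 6 ⟩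
    2 * (3 * x + 1) + 3 * y + 1 + 6 ≡⟨ rearrange x y ⟩
    6 * suc x + 3 * suc y ≤⟨ ℕₚ.+-mono-≤ (ℕₚ.*-monoʳ-≤ 6 x<m) (ℕₚ.*-monoʳ-≤ 3 y<m) ⟩
    6 * m + 3 * m ≡⟨ ℕₚ.*-distribʳ-+ m 6 3 ⟨
    9 * m ≤⟨ 9m≤n ⟩
    n ≤⟨ ℕₚ.m≤m+n n _ ⟩
    2 * n ∎
    where
    rearrange : ∀ x y → 2 * (3 * x + 1) + 3 * y + 1 + 6 ≡ 6 * suc x + 3 * suc y
    rearrange = ℕS.solve-∀
  slanted : Region tri n (gridPoint ε x y)
  slanted = ℤ.+≤+ z≤n ,
    subst₂ (λ i j → i ℤ.+ + 1 ℤ.≤ j) (sym (pos-*-* 3 (3 * y) (3 * y))) (sym (pos-*-* 4 n n)) (ℤ.+≤+ height) ,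
    subst (λ i → + 0 ℤ.≤ i ℤ.+ + (3 * y)) (ℤₚ.pos-* 2 (3 * x + ε)) (ℤ.+≤+ z≤n) ,
    subst₂ (λ i j → i ℤ.+ + (3 * y) ℤ.+ + 1 ℤ.≤ j) (ℤₚ.pos-* 2 (3 * x + ε)) (ℤₚ.pos-* 2 n) (ℤ.+≤+ span)
  go : ∀ t → Region t n (gridPoint ε x y)
  go sq = ℤ.+≤+ z≤n , ℤ.+≤+ x-bound , ℤ.+≤+ z≤n , ℤ.+≤+ y-bound
  go tri = slanted
  go hex = slanted

gridPoint-lat : ∀ t {ε} x y → ε ≤ 1 → T (lat t (gridPoint ε x y))
gridPoint-lat tri x y _ = tt
gridPoint-lat sq  x y _ = tt
gridPoint-lat hex {ε} x y ε≤1 = subst (λ r → T (not (r ℕ.≡ᵇ 2))) (sym toℕ≡) (small ε≤1)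
  where
  small : ∀ {ε} → ε ≤ 1 → T (not (ε ℕ.≡ᵇ 2))
  small z≤n = tt
  small (s≤s z≤n) = tt
  z = + (3 * x + ε) ℤ.- + (3 * y)
  z≡ : z ≡ + ε ℤ.+ (+ x ℤ.- + y) ℤ.* + 3
  z≡ = trans (cong₂ (λ i j → i ℤ.+ + ε ℤ.- j) (ℤₚ.pos-* 3 x) (ℤₚ.pos-* 3 y)) (rearrange (+ ε) (+ x) (+ y))
    where
    rearrange : ∀ e x y → + 3 ℤ.* x ℤ.+ e ℤ.- + 3 ℤ.* y ≡ e ℤ.+ (x ℤ.- y) ℤ.* + 3
    rearrange = solve-∀
  toℕ≡ : toℕ (residue 2 z) ≡ ε
  toℕ≡ = trans (Finₚ.toℕ-fromℕ< (n%ℕd<d z 3)) (remainder-unique 2 (z /ℕ 3) (+ x ℤ.- + y) (n%ℕd<d z 3)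
    (s≤s (ℕₚ.≤-trans ε≤1 (s≤s z≤n))) (trans (sym (a≡a%ℕn+[a/ℕn]*n z 3)) z≡))

-- One eastward dart from each point of an `m` by `m` grid; their starts already tell them apart.
edges-quadratic : ∀ t {m n} → 9 * m ≤ n → m * m ≤ orderedEdges t n
edges-quadratic t {m} {n} 9m≤n = subst (_≤ orderedEdges t n)
  (trans (length-cartesianProduct (allFin m) (allFin m)) (cong₂ _*_ length-allFin length-allFin))
  (≲-length {P = λ _ → ⊤} (Uniqueₚ.cartesianProduct⁺ (Uniqueₚ.allFin⁺ m) (Uniqueₚ.allFin⁺ m)) (λ _ → tt)
    (≲-map (λ {xy} _ → gridEdge xy) (λ {xy} _ → grid-edge xy) (λ {xy} {zw} _ _ → injective xy zw) (edge-≲ t n)))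
  where
  length-allFin : length (allFin m) ≡ m
  length-allFin = Listₚ.length-tabulate id
  gridEdge : Fin m × Fin m → V × V
  gridEdge (x , y) = gridPoint 0 (toℕ x) (toℕ y) , gridPoint 1 (toℕ x) (toℕ y)
  point : ∀ {ε} (x y : Fin m) → ε ≤ 1 → T (inR t n (gridPoint ε (toℕ x) (toℕ y)))
  point {ε} x y ε≤1 = region⇒inR t n _ (gridPoint-region t 9m≤n ε≤1 (Finₚ.toℕ<n x) (Finₚ.toℕ<n y))
    (gridPoint-lat t (toℕ x) (toℕ y) ε≤1)
  grid-edge : ∀ xy → Edge t n (gridEdge xy)
  grid-edge (x , y) = T-∧ (point x y z≤n) (T-∧ (point x y ℕₚ.≤-refl)
    (subst (λ v → T (adj t (gridPoint 0 (toℕ x) (toℕ y)) v)) (sym (gridPoint-east t (toℕ x) (toℕ y)))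
      (adj-step t (gridPoint 0 (toℕ x) (toℕ y)) (east t))))
  injective : ∀ xy zw → gridEdge xy ≡ gridEdge zw → xy ≡ zw
  injective (x , y) (z , w) eq = cong₂ _,_
    (Finₚ.toℕ-injective (ℕₚ.*-cancelˡ-≡ _ _ 3 (ℕₚ.+-cancelʳ-≡ 0 _ _ (ℤₚ.+-injective (cong (proj₁ ∘ proj₁) eq)))))
    (Finₚ.toℕ-injective (ℕₚ.*-cancelˡ-≡ _ _ 3 (ℤₚ.+-injective (cong (proj₂ ∘ proj₁) eq))))

∣-∣-≤ : ∀ {m n d} → m ≤ n + d → n ≤ m + d → ∣ m - n ∣ ≤ d
∣-∣-≤ {m} {n} m≤ n≤ with ℕₚ.≤-total m n
... | inj₁ m≤n = subst (_≤ _) (sym (ℕₚ.m≤n⇒∣m-n∣≡n∸m m≤n)) (ℕₚ.m≤n+o⇒m∸n≤o _ m n≤)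
... | inj₂ n≤m = subst (_≤ _) (sym (ℕₚ.m≤n⇒∣n-m∣≡n∸m n≤m)) (ℕₚ.m≤n+o⇒m∸n≤o _ n m≤)

m≤2*[m/2]+1 : ∀ m → m ≤ 2 * (m ℕ./ 2) + 1
m≤2*[m/2]+1 m = begin
  m ≡⟨ ℕ÷.m≡m%n+[m/n]*n m 2 ⟩
  m ℕ.% 2 + (m ℕ./ 2) * 2 ≤⟨ ℕₚ.+-monoˡ-≤ _ (ℕ.s≤s⁻¹ (ℕ÷.m%n<n m 2)) ⟩
  1 + (m ℕ./ 2) * 2 ≡⟨ rearrange (m ℕ./ 2) ⟩
  2 * (m ℕ./ 2) + 1 ∎
  where
  open ℕₚ.≤-Reasoning
  rearrange : ∀ q → 1 + q * 2 ≡ 2 * q + 1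
  rearrange = ℕS.solve-∀

opaque
  -- The boundary terms are linear in n while ‖R‖ grows quadratically.
  edges-dominate : ∀ t B → ∃[ N ] ∀ n → N ≤ n → B * width n < 2 * ‖R‖ t n
  -- With `q = n / 9`, `width n` is at most `36q + 33`, hence at most `69q` once `q` is positive.
  -- The 2 also ensures `2 ≤ q`, which pays for strictness and for the unit lost in halving
  -- `orderedEdges`.
  edges-dominate t B = (69 * B + 2) * 9 , λ n N≤n → dominate n (q-large n N≤n)
    where
    q-large : ∀ n → (69 * B + 2) * 9 ≤ n → 69 * B + 2 ≤ n ℕ./ 9
    q-large n N≤n = subst (_≤ n ℕ./ 9) (ℕ÷.m*n/n≡m (69 * B + 2) 9) (ℕ÷./-monoˡ-≤ 9 N≤n)
    dominate : ∀ n → 69 * B + 2 ≤ n ℕ./ 9 → B * width n < 2 * ‖R‖ t n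
    dominate n large = ℕₚ.+-cancelʳ-≤ 1 (suc (B * width n)) (2 * ‖R‖ t n) (begin
      suc (B * width n) + 1 ≡⟨ ℕₚ.+-comm (suc (B * width n)) 1 ⟩
      2 + B * width n ≤⟨ ℕₚ.+-mono-≤ 2≤q (ℕₚ.*-monoʳ-≤ B width≤) ⟩
      q + B * (69 * q) ≡⟨ rearrange B q ⟩
      (69 * B + 1) * q ≤⟨ ℕₚ.*-monoˡ-≤ q (ℕₚ.≤-trans (ℕₚ.+-monoʳ-≤ (69 * B) (ℕₚ.n≤1+n 1)) large) ⟩
      q * q ≤⟨ edges-quadratic t {q} (subst (_≤ n) (ℕₚ.*-comm q 9) (ℕ÷.m/n*n≤m n 9)) ⟩
      orderedEdges t n ≤⟨ m≤2*[m/2]+1 (orderedEdges t n) ⟩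
      2 * ‖R‖ t n + 1 ∎)
      where
      open ℕₚ.≤-Reasoning
      q : ℕ
      q = n ℕ./ 9
      2≤q : 2 ≤ q
      2≤q = ℕₚ.≤-trans (ℕₚ.m≤n+m 2 (69 * B)) large
      rearrange : ∀ b q → q + b * (69 * q) ≡ (69 * b + 1) * q
      rearrange = ℕS.solve-∀
      n≤ : n ≤ 8 + q * 9
      n≤ = subst (_≤ 8 + q * 9) (sym (ℕ÷.m≡m%n+[m/n]*n n 9)) (ℕₚ.+-monoˡ-≤ (q * 9) (ℕ.s≤s⁻¹ (ℕ÷.m%n<n n 9)))
      width≤ : width n ≤ 69 * q
      width≤ = begin
        suc (2 * n + 2 * n) ≤⟨ s≤s (ℕₚ.+-mono-≤ (ℕₚ.*-monoʳ-≤ 2 n≤) (ℕₚ.*-monoʳ-≤ 2 n≤)) ⟩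
        suc (2 * (8 + q * 9) + 2 * (8 + q * 9)) ≡⟨ expand q ⟩
        33 * 1 + 36 * q ≤⟨ ℕₚ.+-monoˡ-≤ (36 * q) (ℕₚ.*-monoʳ-≤ 33 (ℕₚ.≤-trans (s≤s z≤n) 2≤q)) ⟩
        33 * q + 36 * q ≡⟨ ℕₚ.*-distribʳ-+ q 33 36 ⟨
        69 * q ∎
        where
        expand : ∀ q → suc (2 * (8 + q * 9) + 2 * (8 + q * 9)) ≡ 33 * 1 + 36 * q
        expand = ℕS.solve-∀

-- Halving `e` may lose 1; since `1 ≤ w`, the `suc` in the coefficient absorbs it.
estimate : ∀ k {c p e} A B w → 1 ≤ w → c ≤ p → p * (suc k * k) ≤ e + B * w → e ≤ c * (suc k * k) + A * w →
  ∣ (k + 1) * (k * c) - 2 * (e ℕ./ 2) ∣ ≤ suc (A + B) * w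
estimate k {c} {p} {e} A B w 1≤w c≤p upper lower = ∣-∣-≤ above below
  where
  open ℕₚ.≤-Reasoning
  rearrange : ∀ k c → c * (suc k * k) ≡ (k + 1) * (k * c)
  rearrange = ℕS.solve-∀
  above : (k + 1) * (k * c) ≤ 2 * (e ℕ./ 2) + suc (A + B) * w
  above = begin
    (k + 1) * (k * c) ≡⟨ rearrange k c ⟨
    c * (suc k * k) ≤⟨ ℕₚ.*-monoˡ-≤ (suc k * k) c≤p ⟩
    p * (suc k * k) ≤⟨ upper ⟩
    e + B * w ≤⟨ ℕₚ.+-monoˡ-≤ (B * w) (m≤2*[m/2]+1 e) ⟩
    2 * (e ℕ./ 2) + 1 + B * w ≡⟨ ℕₚ.+-assoc (2 * (e ℕ./ 2)) 1 (B * w) ⟩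
    2 * (e ℕ./ 2) + (1 + B * w) ≤⟨ ℕₚ.+-monoʳ-≤ (2 * (e ℕ./ 2)) (ℕₚ.+-mono-≤ 1≤w (ℕₚ.*-monoˡ-≤ w (ℕₚ.m≤n+m B A))) ⟩
    2 * (e ℕ./ 2) + suc (A + B) * w ∎
  below : 2 * (e ℕ./ 2) ≤ (k + 1) * (k * c) + suc (A + B) * w
  below = begin
    2 * (e ℕ./ 2) ≡⟨ ℕₚ.*-comm 2 (e ℕ./ 2) ⟩
    (e ℕ./ 2) * 2 ≤⟨ ℕ÷.m/n*n≤m e 2 ⟩
    e ≤⟨ lower ⟩
    c * (suc k * k) + A * w
      ≤⟨ ℕₚ.+-mono-≤ (ℕₚ.≤-reflexive (rearrange k c)) (ℕₚ.*-monoˡ-≤ w (ℕₚ.m≤n⇒m≤1+n (ℕₚ.m≤m+n A B))) ⟩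
    (k + 1) * (k * c) + suc (A + B) * w ∎

opaque
  -- The minimum comes from an exhaustive search, which `opaque` keeps from unfolding in the
  -- arithmetic that follows.
  cl : ∀ t n → Σ ℕ (IsCl t n)
  cl t n = least-maximal (vertices t n) (inR⇒vertex t n)

  -- Minimality compares `c` with the packing of `few-faces`, while a packing that attains `c` is
  -- itself subject to `faces-dominated`.
  cl-estimate : ∀ t → ∃[ D ] ∀ n → ∣ (sides t + 1) * (sides t * proj₁ (cl t n)) - 2 * ‖R‖ t n ∣ ≤ D * width n
  cl-estimate t = suc (A + B) , λ n →
    let c , (P , max , ∣P∣≡c) , least = cl t n
        Q , maxQ , few = proj₂ (few-faces t) n
    in estimate (sides t) {c} {length Q} {orderedEdges t n} A B (width n) (s≤s z≤n) (least Q maxQ) few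
         (subst (λ l → orderedEdges t n ≤ l * (suc (sides t) * sides t) + A * width n) ∣P∣≡c (proj₂ (faces-dominated t) n P max))
    where
    A B : ℕ
    A = proj₁ (faces-dominated t)
    B = proj₁ (few-faces t)

-- The limit with denominators cleared: dividing by `suc m * (sides t + 1) * ‖R‖ t n` gives distance
-- less than 1/(m + 1) from 2/(k + 1). Strictness forces `‖R‖ t n` to be positive, so the quotient
-- is defined.
theorem3 : (t : Tiling) →
    Σ[ c ∈ (ℕ → ℕ) ] ((∀ n → IsCl t n (c n)) ×
    (∀ m → ∃[ N ] ∀ n → N ≤ n →
    suc m * ∣ (sides t + 1) * (sides t * c n) - 2 * ‖R‖ t n ∣ < (sides t + 1) * ‖R‖ t n))
theorem3 t = proj₁ ∘ cl t , proj₂ ∘ cl t , limit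
  where
  2≤sides+1 : ∀ t → 2 ≤ sides t + 1
  2≤sides+1 tri = s≤s (s≤s z≤n)
  2≤sides+1 sq  = s≤s (s≤s z≤n)
  2≤sides+1 hex = s≤s (s≤s z≤n)
  scale : ∀ m D w {x e k} → x ≤ D * w → suc m * D * w < 2 * e → 2 ≤ k → suc m * x < k * e
  scale m D w {x} {e} {k} x≤ <e 2≤k = begin-strict
    suc m * x ≤⟨ ℕₚ.*-monoʳ-≤ (suc m) x≤ ⟩
    suc m * (D * w) ≡⟨ ℕₚ.*-assoc (suc m) D w ⟨
    suc m * D * w <⟨ <e ⟩
    2 * e ≤⟨ ℕₚ.*-monoˡ-≤ e 2≤k ⟩
    k * e ∎
    where open ℕₚ.≤-Reasoning
  limit : ∀ m → ∃[ N ] ∀ n → N ≤ n →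
    suc m * ∣ (sides t + 1) * (sides t * proj₁ (cl t n)) - 2 * ‖R‖ t n ∣ < (sides t + 1) * ‖R‖ t n
  -- The factor `suc m` is absorbed into the constant before the threshold is chosen.
  limit m = proj₁ (edges-dominate t (suc m * proj₁ (cl-estimate t))) , λ n N≤n →
    scale m (proj₁ (cl-estimate t)) (width n) {∣ (sides t + 1) * (sides t * proj₁ (cl t n)) - 2 * ‖R‖ t n ∣} {‖R‖ t n} {sides t + 1}
      (proj₂ (cl-estimate t) n)
      (proj₂ (edges-dominate t (suc m * proj₁ (cl-estimate t))) n N≤n) (2≤sides+1 t)
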